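{- For every integer $\ell\geq 1$, there exists an integer $k$ such that every graph with minimum degree at least $k$ contains $K'_{\ell,\ell}$ as a cyclic minor.
   Context: All graphs are finite and simple. A graph $H$ is a cyclic minor of a graph $G$ if a graph isomorphic to $H$ can be obtained from a subgraph of $G$ that has a Hamiltonian cycle $C$ by contracting some of the edges of $C$ (contractions keep the graph simple). $K'_{\ell,\ell}$ denotes the graph obtained from the complete bipartite graph $K_{\ell,\ell}$ by adding, on each of the two partite sets, the edges of a path passing through all vertices of that partite set. -}

module Defs where

open import Data.Nat using (ℕ; zero; suc; _+_; _≤_; _<_; _<ᵇ_; _≡ᵇ_)
open import Data.Nat.Properties using (_<?_)
open import Data.Fin using (Fin; toℕ; fromℕ<)
open import Data.Bool using (Bool; true; false; if_then_else_; _∨_; _xor_)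
open import Data.List using (List; map; allFin)
open import Data.Nat.ListAction using (sum)
open import Data.Product using (Σ; ∃; _×_)
open import Data.Sum using (_⊎_)
open import Relation.Nullary using (¬_; yes; no)
open import Relation.Binary.PropositionalEquality using (_≡_)
open import Function.Definitions using (Injective; Surjective)

record Graph (n : ℕ) : Set where
  field
    adj    : Fin n → Fin n → Bool
    sym    : ∀ u v → adj u v ≡ adj v u
    irrefl : ∀ v → adj v v ≡ false
open Graph public

degree : ∀ {n} → Graph n → Fin n → ℕ
degree {n} G v = sum (map (λ w → if adj G v w then 1 else 0) (allFin n))

-- K'_{ℓ,ℓ} on Fin (ℓ + ℓ): vertices with index < ℓ form side A, the others
-- side B; all A–B pairs are adjacent, and within a side two vertices are
-- adjacent iff their indices are consecutive (a path through the side).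
K′ : (ℓ : ℕ) → Fin (ℓ + ℓ) → Fin (ℓ + ℓ) → Bool
K′ ℓ u v =
  if (toℕ u <ᵇ ℓ) xor (toℕ v <ᵇ ℓ)
  then true
  else ((suc (toℕ u) ≡ᵇ toℕ v) ∨ (suc (toℕ v) ≡ᵇ toℕ u))

next : ∀ {m} → Fin m → Fin m
next {suc k} i with suc (toℕ i) <? suc k
... | yes p = fromℕ< p
... | no _  = Fin.zero

iter : ∀ {A : Set} → ℕ → (A → A) → A → A
iter zero    f a = a
iter (suc t) f a = f (iter t f a)

ForwardArc : ∀ {m} → (Fin m → Set) → Fin m → Fin m → Set
ForwardArc P i j =
  ∃ λ t → (iter t next i ≡ j) × (∀ s → s ≤ t → P (iter s next i))

-- H (on Fin h, given by its adjacency) is a cyclic minor of G: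
-- a subgraph of G with vertex set {c 0, …, c (m-1)} (m ≥ 3, c injective)
-- and edge set S (symmetric, contained in E(G)) having the Hamiltonian cycle
-- c 0, c 1, …, c (m-1), c 0; contracting edges of that cycle merges the
-- cyclic arcs φ⁻¹(x) into single vertices x of H (φ surjective, fibres are
-- arcs of the cycle); the resulting simple graph is H.
record CyclicMinorModel {h n : ℕ} (H : Fin h → Fin h → Bool) (G : Graph n) : Set where
  field
    m        : ℕ
    m≥3      : 3 ≤ m
    c        : Fin m → Fin n
    c-inj    : Injective _≡_ _≡_ c
    S        : Fin m → Fin m → Bool
    S-sym    : ∀ i j → S i j ≡ S j i
    S⊆G      : ∀ i j → S i j ≡ true → adj G (c i) (c j) ≡ true
    ham      : ∀ i → S i (next i) ≡ true
    φ        : Fin m → Fin h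
    φ-surj   : Surjective _≡_ _≡_ φ
    φ-arcs   : ∀ i j → φ i ≡ φ j →
               ForwardArc (λ k → φ k ≡ φ i) i j ⊎ ForwardArc (λ k → φ k ≡ φ i) j i
    φ-edges  : ∀ x y → ¬ (x ≡ y) →
               (H x y ≡ true → ∃ λ i → ∃ λ j → φ i ≡ x × φ j ≡ y × S i j ≡ true)
             × ((∃ λ i → ∃ λ j → φ i ≡ x × φ j ≡ y × S i j ≡ true) → H x y ≡ true)

IsCyclicMinor : ∀ {h n} → (Fin h → Fin h → Bool) → Graph n → Set
IsCyclicMinor H G = CyclicMinorModel H G

{-# OPTIONS --safe #-}

-- Rotate a path with one fixed end (Pósa) until the set R of attainable free ends is closed and
-- no free end has a neighbour off the path. All neighbours of R then lie in a set U ⊇ R with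
-- |U| ≤ 3|R|, and the last of them on the path closes a cycle through R ∪ N(R). Hence the
-- adjacency matrix of the vertices of U on the cycle, taken in cyclic order, has at least
-- (k/3)|U| ones.
--
-- By the Marcus–Tardos argument a matrix with that many ones can be cut into 2ℓ row intervals and
-- 2ℓ column intervals so that every block contains a one. Half of the row intervals and half of
-- the column intervals are separated on the cycle; these are the branch sets of K′ ℓ.

module Submission where

open import Defs
open import Data.Nat
open import Data.Nat.DivMod
open import Data.Nat.Divisibility using (divides-refl)
open import Data.Nat.ListAction using (sum)
open import Data.Nat.ListAction.Properties using (sum-↭)
open import Data.Nat.Properties
open import Data.Nat.Solver using (module +-*-Solver)
open import Data.Bool as Bool using (Bool; true; false; if_then_else_; _∧_; _∨_; _xor_; not; T)
open import Data.Bool.Properties using (T-≡; ∨-comm; ∨-zeroʳ; xor-comm)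
open import Data.Empty using (⊥-elim)
open import Data.Fin as Fin using (Fin; toℕ; fromℕ<)
open import Data.Fin.Properties as Fin using (toℕ-fromℕ<; toℕ-injective; toℕ<n)
open import Data.List using (List; []; _∷_; _++_; [_]; map; length; lookup; filter; concatMap; allFin; upTo)
open import Data.List.Membership.Propositional using (_∈_; _∉_; find; lose)
open import Data.List.Membership.Propositional.Properties using (∈-map⁺; ∈-map⁻; ∈-++⁺ˡ; ∈-++⁺ʳ; ∈-++⁻; ∈-∃++; ∈-concatMap⁺; ∈-allFin; ∈-length; ∈-upTo⁺; ∈-filter⁺; ∈-filter⁻; ∈-lookup)
open import Data.List.Properties using (++-assoc; length-++; length-tabulate; ∷-injective)
open import Data.List.Relation.Binary.Permutation.Propositional using (_↭_; ↭-refl; ↭-sym; ↭-trans; ↭⇒↭ₛ)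
open import Data.List.Relation.Binary.Permutation.Propositional.Properties using (shift; ∈-resp-↭; ↭-length; map⁺)
import Data.List.Relation.Binary.Permutation.Setoid.Properties as ↭ₛ
open import Data.List.Relation.Unary.All as All using ([]; _∷_)
import Data.List.Relation.Unary.All.Properties as All
open import Data.List.Relation.Unary.AllPairs using ([]; _∷_)
open import Data.List.Relation.Unary.Any using (Any; here; there; any?)
open import Data.List.Relation.Unary.Unique.Propositional using (Unique)
open import Data.List.Relation.Unary.Unique.Propositional.Properties using (allFin⁺; filter⁺; Unique[x∷xs]⇒x∉xs)
open import Data.Maybe using (Maybe; just; nothing; maybe)
open import Data.Product using (∃; ∃₂; _×_; _,_; proj₁; proj₂)
open import Data.Sum using (_⊎_; inj₁; inj₂; map₁)
open import Function using (_∘_; flip)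
open import Function.Bundles using (Equivalence)
open import Relation.Binary.PropositionalEquality using (_≡_; _≢_; refl; cong; cong₂; subst; subst₂; trans; setoid) renaming (sym to ≡-sym)
open import Relation.Nullary using (¬_; Dec; yes; no; does)
open import Relation.Nullary.Decidable using (dec-true; _×-dec_)
open import Relation.Unary using (Decidable)

-- The paths inside the two sides of K′ come for free: if the branch sets are consecutive arcs of
-- the cycle, the first ℓ of them forming one side, the cycle itself supplies these paths, and its
-- two passages between the sides are edges that K′ has anyway. What has to be found are the ℓ²
-- edges joining arcs of different sides, hence a matrix problem about interval blocks. The obstacle
-- is that a long cycle need not be dense: most of its vertices may have few neighbours on it. Only
-- the vertices of R are known to have all their neighbours there, and counting the edges at R pays
-- off only inside a set not much larger than R. This is why U is needed; the cycle vertices outside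
-- U are ignored by the matrix and absorbed into the arcs afterwards. Rows and columns are indexed
-- by the same vertices, so row intervals may overlap column intervals. Asking for 2ℓ of each leaves
-- room to choose ℓ of each on different sides of a cut. If more than d * N ones force a grid,
-- degree k = 3 + 3d suffices: 3d pays for |U| ≤ 3|R|, and the extra 3 makes the count strict and
-- the cycle long enough.

all-or : ∀ {X : Set} {A : X → Set} {B : Set} xs →
  (∀ {x} → x ∈ xs → A x ⊎ B) → (∀ {x} → x ∈ xs → A x) ⊎ B
all-or []       dec = inj₁ λ ()
all-or (x ∷ xs) dec with dec (here refl) | all-or xs (dec ∘ there)
... | inj₂ b | _      = inj₂ b
... | inj₁ _ | inj₂ b = inj₂ b
... | inj₁ a | inj₁ f = inj₁ λ { (here refl) → a ; (there x∈xs) → f x∈xs }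

-- Finite sums of natural numbers

ind : Bool → ℕ
ind b = if b then 1 else 0

ind≤1 : ∀ b → ind b ≤ 1
ind≤1 true  = ≤-refl
ind≤1 false = z≤n

∑ : ℕ → (ℕ → ℕ) → ℕ
∑ zero    f = 0
∑ (suc n) f = ∑ n f + f n

∑-mono : ∀ n {f g} → (∀ i → i < n → f i ≤ g i) → ∑ n f ≤ ∑ n g
∑-mono zero    f≤g = z≤n
∑-mono (suc n) f≤g = +-mono-≤ (∑-mono n λ i i<n → f≤g i (m<n⇒m<1+n i<n)) (f≤g n (n<1+n n))

∑-cong : ∀ n {f g} → (∀ i → i < n → f i ≡ g i) → ∑ n f ≡ ∑ n g
∑-cong zero    f≡g = refl
∑-cong (suc n) f≡g = cong₂ _+_ (∑-cong n λ i i<n → f≡g i (m<n⇒m<1+n i<n)) (f≡g n (n<1+n n))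

∑-+ : ∀ n f g → ∑ n (λ i → f i + g i) ≡ ∑ n f + ∑ n g
∑-+ zero    f g = refl
∑-+ (suc n) f g rewrite ∑-+ n f g =
  solve 4 (λ a b c d → (a :+ b) :+ (c :+ d) := (a :+ c) :+ (b :+ d)) refl (∑ n f) (∑ n g) (f n) (g n)
  where open +-*-Solver

∑-*ˡ : ∀ n c f → ∑ n (λ i → c * f i) ≡ c * ∑ n f
∑-*ˡ zero    c f = ≡-sym (*-zeroʳ c)
∑-*ˡ (suc n) c f rewrite ∑-*ˡ n c f = ≡-sym (*-distribˡ-+ c (∑ n f) (f n))

∑-const : ∀ n c → ∑ n (λ _ → c) ≡ n * c
∑-const zero    c = refl
∑-const (suc n) c rewrite ∑-const n c = +-comm (n * c) c

∑-≤ : ∀ n c {f} → (∀ i → i < n → f i ≤ c) → ∑ n f ≤ n * c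
∑-≤ n c {f} f≤c = subst (∑ n f ≤_) (∑-const n c) (∑-mono n f≤c)

∑-++ : ∀ m n f → ∑ (m + n) f ≡ ∑ m f + ∑ n (λ i → f (m + i))
∑-++ m zero    f rewrite +-identityʳ m | +-identityʳ (∑ m f) = refl
∑-++ m (suc n) f rewrite +-suc m n | ∑-++ m n f =
  +-assoc (∑ m f) _ _

∑-monoˡ : ∀ {m n} f → m ≤ n → ∑ m f ≤ ∑ n f
∑-monoˡ {m} f m≤n with m≤n⇒∃[o]m+o≡n m≤n
... | o , refl rewrite ∑-++ m o f = m≤m+n _ _

∑-blocks : ∀ q s f → ∑ (q * s) f ≡ ∑ q λ a → ∑ s λ i → f (a * s + i)
∑-blocks zero    s f = refl
∑-blocks (suc q) s f rewrite +-comm s (q * s) | ∑-++ (q * s) s f | ∑-blocks q s f = refl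

∑-swap : ∀ m n (f : ℕ → ℕ → ℕ) → ∑ m (λ i → ∑ n (f i)) ≡ ∑ n (λ j → ∑ m (flip f j))
∑-swap zero    n f = ≡-sym (trans (∑-const n 0) (*-zeroʳ n))
∑-swap (suc m) n f rewrite ∑-swap m n f = ≡-sym (∑-+ n (λ j → ∑ m (flip f j)) (f m))

-- Counting and ranks of Boolean predicates on ℕ

# : ℕ → (ℕ → Bool) → ℕ
# n χ = ∑ n (ind ∘ χ)

#≤n : ∀ n χ → # n χ ≤ n
#≤n n χ = subst (# n χ ≤_) (*-identityʳ n) (∑-≤ n 1 λ i _ → ind≤1 (χ i))

#-split : ∀ n (χ ψ : ℕ → Bool) → # n χ ≡ # n (λ i → χ i ∧ ψ i) + # n (λ i → χ i ∧ not (ψ i))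
#-split n χ ψ = trans (∑-cong n λ i _ → split (χ i) (ψ i)) (∑-+ n _ _)
  where
  split : ∀ b c → ind b ≡ ind (b ∧ c) + ind (b ∧ not c)
  split true  true  = refl
  split true  false = refl
  split false _     = refl

-- The witness is the true index of rank t, counted from 0. Thus `λ x → # x χ` is a monotone
-- labelling that takes every value below `# n χ` at a true index; the interval partitions of
-- `wide-grid` are of this kind.
#-select : ∀ n χ {t} → t < # n χ → ∃ λ x → x < n × χ x ≡ true × # x χ ≡ t
#-select (suc n) χ {t} t<# with t <? # n χ
... | yes t<#n with #-select n χ t<#n
...   | x , x<n , rest = x , m<n⇒m<1+n x<n , rest
#-select (suc n) χ {t} t<# | no t≮#n with χ n in eq
... | true  = n , n<1+n n , eq , ≤-antisym (≮⇒≥ t≮#n) (s≤s⁻¹ (subst (t <_) (+-comm _ 1) t<#))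
... | false = ⊥-elim (t≮#n (subst (t <_) (+-identityʳ _) t<#))

true⇒1≤# : ∀ n χ {i} → i < n → χ i ≡ true → 1 ≤ # n χ
true⇒1≤# (suc n) χ {i} i<1+n χi with i ≟ n
... | yes refl rewrite χi = m≤n+m 1 _
... | no i≢n = ≤-trans (true⇒1≤# n χ (≤∧≢⇒< (s≤s⁻¹ i<1+n) i≢n) χi) (m≤m+n _ _)

≤ᵇ-true⁻ : ∀ k n → (k ≤ᵇ n) ≡ true → k ≤ n
≤ᵇ-true⁻ k n eq = ≤ᵇ⇒≤ k n (subst T (≡-sym eq) _)

≤ᵇ-false⁻ : ∀ k n → (k ≤ᵇ n) ≡ false → n ≤ k
≤ᵇ-false⁻ k n eq with k ≤? n
... | no k≰n  = <⇒≤ (≰⇒> k≰n)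
... | yes k≤n = ⊥-elim (subst T eq (≤⇒≤ᵇ k≤n))

some : ℕ → (ℕ → Bool) → Bool
some n χ = 1 ≤ᵇ # n χ

some⁺ : ∀ n χ {i} → i < n → χ i ≡ true → some n χ ≡ true
some⁺ n χ i<n χi = Equivalence.to T-≡ (≤⇒≤ᵇ (true⇒1≤# n χ i<n χi))

some⁻ : ∀ n χ → some n χ ≡ true → ∃ λ i → i < n × χ i ≡ true
some⁻ n χ eq with #-select n χ (≤ᵇ-true⁻ 1 (# n χ) eq)
... | i , i<n , χi , _ = i , i<n , χi

Agreeing : (s : ℕ) (P : ℕ → ℕ → Bool) (k n : ℕ) (χ : ℕ → Bool) → Set
Agreeing s P k n χ = ∃ λ χ′ → (∀ x → χ′ x ≡ true → χ x ≡ true) × k ≤ # n χ′ ×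
  (∀ j → j < s → ∀ x y → χ′ x ≡ true → χ′ y ≡ true → P x j ≡ P y j)

agreeing-suc : ∀ {s P k χ χ₁} n v → (∀ x → χ₁ x ≡ true → χ x ≡ true × P x s ≡ v) →
  Agreeing s P k n χ₁ → Agreeing (suc s) P k n χ
agreeing-suc {s} {P} n v χ₁⇒ (χ′ , χ′⊆ , k≤ , agree) =
  χ′ , (λ x p → proj₁ (χ₁⇒ x (χ′⊆ x p))) , k≤ , agree′
  where
  agree′ : ∀ j → j < suc s → ∀ x y → χ′ x ≡ true → χ′ y ≡ true → P x j ≡ P y j
  agree′ j j<1+s x y p q with j ≟ s
  ... | yes refl = trans (proj₂ (χ₁⇒ x (χ′⊆ x p))) (≡-sym (proj₂ (χ₁⇒ y (χ′⊆ y q))))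
  ... | no j≢s   = agree j (≤∧≢⇒< (s≤s⁻¹ j<1+s) j≢s) x y p q

-- Keep the larger half for each of the s coordinates in turn.
agreeing : ∀ s P k n χ → k * 2 ^ s ≤ # n χ → Agreeing s P k n χ
agreeing zero    P k n χ large = χ , (λ _ p → p) , subst (_≤ # n χ) (*-identityʳ k) large , λ _ ()
agreeing (suc s) P k n χ large with k * 2 ^ s ≤? # n (λ i → χ i ∧ P i s)
... | yes big = agreeing-suc n true (λ x → ∧-true (χ x)) (agreeing s P k n _ big)
  where
  ∧-true : ∀ a {b} → a ∧ b ≡ true → a ≡ true × b ≡ true
  ∧-true true p = refl , p
... | no small = agreeing-suc n false (λ x → ∧-not-true (χ x) (P x s)) (agreeing s P k n _ big)
  where
  open ≤-Reasoning
  ∧-not-true : ∀ a b → a ∧ not b ≡ true → a ≡ true × b ≡ false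
  ∧-not-true true false p = refl , refl
  big : k * 2 ^ s ≤ # n (λ i → χ i ∧ not (P i s))
  big = +-cancelˡ-≤ (k * 2 ^ s) _ _ (begin
    k * 2 ^ s + k * 2 ^ s
      ≡⟨ solve 2 (λ a b → a :* b :+ a :* b := a :* (b :+ (b :+ con 0))) refl k (2 ^ s) ⟩
    k * 2 ^ suc s
      ≤⟨ large ⟩
    # n χ
      ≡⟨ #-split n χ (λ i → P i s) ⟩
    # n (λ i → χ i ∧ P i s) + # n (λ i → χ i ∧ not (P i s))
      ≤⟨ +-monoˡ-≤ _ (<⇒≤ (≰⇒> small)) ⟩
    k * 2 ^ s + # n (λ i → χ i ∧ not (P i s)) ∎)
    where open +-*-Solver

-- Grids in dense 0/1 matrices

Matrix : Set
Matrix = ℕ → ℕ → Bool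

Mono : (ℕ → ℕ) → Set
Mono f = ∀ {i j} → i ≤ j → f i ≤ f j

-- The fibres of f and g are intervals of rows and columns, and each of the K × K
-- blocks they cut out contains a one.
record Grid (K : ℕ) (M : Matrix) : Set where
  field
    f g    : ℕ → ℕ
    f-mono : Mono f
    g-mono : Mono g
    hit    : ∀ {a b} → a < K → b < K → ∃ λ i → ∃ λ j → f i ≡ a × g j ≡ b × M i j ≡ true

#-mono : ∀ χ → Mono (λ i → # i χ)
#-mono χ = ∑-monoˡ (ind ∘ χ)

transpose-grid : ∀ {K M} → Grid K (flip M) → Grid K M
transpose-grid G = record
  { f = g ; g = f ; f-mono = g-mono ; g-mono = f-mono
  ; hit = λ a<K b<K → let i , j , p , q , r = hit b<K a<K in j , i , q , p , r }
  where open Grid G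

ones : ℕ → Matrix → ℕ
ones n M = ∑ n λ i → # n (M i)

module MarcusTardos (K : ℕ) (K≥1 : 1 ≤ K) where

  -- Side length of the blocks. A nonempty block that is neither wide nor tall has at most K * K
  -- ones, so these blocks contribute at most K * K * density * q; taking s one larger than K * K
  -- leaves exactly density * q for the wide and tall blocks.
  s : ℕ
  s = suc (K * K)

  -- Pigeonhole over the 2 ^ s possible sets of nonempty columns: among this many wide blocks in one
  -- block column, K have the same set.
  wideBound : ℕ
  wideBound = K * 2 ^ s

  -- A wide or tall block is charged its full s * s entries. Each block column has at most
  -- `wideBound` wide blocks and each block row as many tall ones, whence the factor 2.
  density : ℕ
  density = 2 * (s * s * wideBound)

  block : Matrix → ℕ → ℕ → Matrix
  block M a b i j = M (a * s + i) (b * s + j)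

  column : Matrix → ℕ → ℕ → ℕ → Bool
  column M a b j = some s (λ i → block M a b i j)

  contract : Matrix → Matrix
  contract M a b = some s (column M a b)

  -- Tall blocks are the wide blocks of `flip M`.
  wide : Matrix → ℕ → ℕ → Bool
  wide M a b = K ≤ᵇ # s (column M a b)

  quotient : ∀ a {i} → i < s → (a * s + i) / s ≡ a
  quotient a {i} i<s = trans (+-distrib-/-∣ˡ {a * s} i (divides-refl a))
    (trans (cong₂ _+_ (m*n/n≡m a s) (m<n⇒m/n≡0 i<s)) (+-identityʳ a))

  lift-grid : ∀ {M} → Grid K (contract M) → Grid K M
  lift-grid {M} G = record
    { f = λ i → f (i / s) ; g = λ j → g (j / s)
    ; f-mono = λ i≤j → f-mono (/-monoˡ-≤ s i≤j) ; g-mono = λ i≤j → g-mono (/-monoˡ-≤ s i≤j)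
    ; hit = hit′ }
    where
    open Grid G
    hit′ : ∀ {a b} → a < K → b < K → ∃ λ i → ∃ λ j → f (i / s) ≡ a × g (j / s) ≡ b × M i j ≡ true
    hit′ a<K b<K =
      let x , y , fx , gy , one = hit a<K b<K
          j , j<s , col         = some⁻ s (column M x y) one
          i , i<s , Mij         = some⁻ s (λ i → block M x y i j) col
      in x * s + i , y * s + j ,
         trans (cong f (quotient x i<s)) fx , trans (cong g (quotient y j<s)) gy , Mij

  -- By pigeonhole K of the wide blocks share their set ψ of nonempty columns, and ψ has at least K
  -- elements. Each chosen block therefore has a one in every column of ψ; rows are labelled by the
  -- rank of their block, columns by their rank in ψ.
  wide-grid : ∀ M q b → wideBound ≤ # q (λ a → wide M a b) → Grid K M
  wide-grid M q b many with agreeing s (λ a j → column M a b j) K q (λ a → wide M a b) many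
  ... | χ , χ⊆wide , K≤#χ , agree with #-select q χ (≤-trans K≥1 K≤#χ)
  ...   | x₀ , _ , χx₀ , _ = record
    -- Truncated subtraction gives label 0 to all columns left of block column b, which keeps the
    -- labelling monotone.
    { f = λ i → # (i / s) χ ; g = λ j → # (j ∸ b * s) ψ
    ; f-mono = λ i≤j → #-mono χ (/-monoˡ-≤ s i≤j)
    ; g-mono = λ i≤j → #-mono ψ (∸-monoˡ-≤ (b * s) i≤j)
    ; hit = hit }
    where
    ψ = column M x₀ b
    K≤#ψ : K ≤ # s ψ
    K≤#ψ = ≤ᵇ-true⁻ K (# s ψ) (χ⊆wide x₀ χx₀)
    hit : ∀ {α β} → α < K → β < K →
      ∃ λ i → ∃ λ j → # (i / s) χ ≡ α × # (j ∸ b * s) ψ ≡ β × M i j ≡ true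
    hit α<K β<K =
      let x , _ , χx , #x   = #-select q χ (<-≤-trans α<K K≤#χ)
          j , j<s , ψj , #j = #-select s ψ (<-≤-trans β<K K≤#ψ)
          i , i<s , one     = some⁻ s (λ i → block M x b i j)
                                (trans (agree j j<s x x₀ χx χx₀) ψj)
      in x * s + i , b * s + j ,
         trans (cong (λ y → # y χ) (quotient x i<s)) #x ,
         trans (cong (λ y → # y ψ) (m+n∸m≡n (b * s) j)) #j , one

  block≤rows*columns : ∀ M a b → ones s (block M a b) ≤ # s (column (flip M) b a) * # s (column M a b)
  block≤rows*columns M a b = begin
    ones s (block M a b)
      ≤⟨ ∑-mono s (λ i i<s → ∑-mono s λ j j<s → cell i j i<s j<s) ⟩
    ∑ s (λ i → ∑ s λ j → ind (row i) * ind (col j))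
      ≡⟨ ∑-cong s (λ i _ → ∑-*ˡ s (ind (row i)) (ind ∘ col)) ⟩
    ∑ s (λ i → ind (row i) * # s col)
      ≡⟨ ∑-cong s (λ i _ → *-comm (ind (row i)) _) ⟩
    ∑ s (λ i → # s col * ind (row i))
      ≡⟨ ∑-*ˡ s (# s col) (ind ∘ row) ⟩
    # s col * # s row
      ≡⟨ *-comm (# s col) _ ⟩
    # s row * # s col ∎
    where
    open ≤-Reasoning
    row = column (flip M) b a
    col = column M a b
    cell : ∀ i j → i < s → j < s → ind (block M a b i j) ≤ ind (row i) * ind (col j)
    cell i j i<s j<s with block M a b i j in eq
    ... | false = z≤n
    ... | true rewrite some⁺ s (λ j → block M a b i j) j<s eq
                     | some⁺ s (λ i → block M a b i j) i<s eq = ≤-refl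

  -- The Booleans stand for nonempty, wide and tall; S is the trivial bound for a block, L the bound
  -- for one that is neither wide nor tall.
  by-cases : ∀ c w t {x S L} → x ≤ S → (c ≡ false → x ≤ 0) → (w ≡ false → t ≡ false → x ≤ L) →
    x ≤ L * ind c + (S * ind w + S * ind t)
  by-cases c true t {x} {S} {L} x≤S _ _ = ≤-trans x≤S
    (≤-trans (≤-reflexive (≡-sym (*-identityʳ S))) (≤-trans (m≤m+n _ _) (m≤n+m _ (L * ind c))))
  by-cases c false true {x} {S} {L} x≤S _ _ = ≤-trans x≤S
    (≤-trans (≤-reflexive (≡-sym (*-identityʳ S))) (≤-trans (m≤n+m _ (S * 0)) (m≤n+m _ (L * ind c))))
  by-cases true false false {L = L} _ _ x≤L = ≤-trans (x≤L refl refl)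
    (≤-trans (≤-reflexive (≡-sym (*-identityʳ L))) (m≤m+n _ _))
  by-cases false false false _ x≤0 _ = ≤-trans (x≤0 refl) z≤n

  block-bound : ∀ M a b → ones s (block M a b) ≤
    K * K * ind (contract M a b) + (s * s * ind (wide M a b) + s * s * ind (wide (flip M) b a))
  block-bound M a b = by-cases (contract M a b) (wide M a b) (wide (flip M) b a)
    (∑-≤ s s λ i _ → #≤n s _)
    (λ empty → ≤-trans (block≤rows*columns M a b)
      (≤-reflexive (trans (cong (rows *_) (no-column empty)) (*-zeroʳ rows))))
    (λ narrow short → ≤-trans (block≤rows*columns M a b)
      (*-mono-≤ (≤ᵇ-false⁻ K rows short) (≤ᵇ-false⁻ K columns narrow)))
    where
    rows    = # s (column (flip M) b a)
    columns = # s (column M a b)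
    no-column : contract M a b ≡ false → columns ≡ 0
    no-column empty with columns | empty
    ... | zero | _ = refl

  few-wide : ∀ M q → (∀ b → b < q → # q (λ a → wide M a b) ≤ wideBound) ⊎ Grid K M
  few-wide M q = map₁ (λ few b b<q → few (∈-upTo⁺ b<q)) (all-or (upTo q) λ {b} _ → dec b)
    where
    dec : ∀ b → (# q (λ a → wide M a b) ≤ wideBound) ⊎ Grid K M
    dec b with wideBound ≤? # q (λ a → wide M a b)
    ... | yes p = inj₂ (wide-grid M q b p)
    ... | no p  = inj₁ (<⇒≤ (≰⇒> p))

  ones-blocks : ∀ M q → ones (q * s) M ≡ ∑ q λ a → ∑ q λ b → ones s (block M a b)
  ones-blocks M q = trans (∑-blocks q s _) (∑-cong q λ a _ →
    trans (∑-cong s λ i _ → ∑-blocks q s _)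
      (∑-swap s q λ i b → ∑ s λ j → ind (block M a b i j)))

  -- Induction on e through `contract`; with powers of s as sizes the division into blocks is exact
  -- at every level.
  grid-or-sparse : ∀ e M → Grid K M ⊎ (ones (s ^ e) M ≤ density * s ^ e)
  grid-or-sparse zero M = inj₂ (begin
    ind (M 0 0)   ≤⟨ ind≤1 (M 0 0) ⟩
    1             ≤⟨ *-mono-≤ {1} {2} {1} (s≤s z≤n) (*-mono-≤ {1} {s * s} {1} (s≤s z≤n) (*-mono-≤ K≥1 (m^n>0 2 s))) ⟩
    density       ≡⟨ *-identityʳ density ⟨
    density * 1   ∎)
    where open ≤-Reasoning
  grid-or-sparse (suc e) M with grid-or-sparse e (contract M) | few-wide M (s ^ e) | few-wide (flip M) (s ^ e)
  ... | inj₁ G | _      | _      = inj₁ (lift-grid G)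
  ... | inj₂ _ | inj₂ G | _      = inj₁ G
  ... | inj₂ _ | inj₁ _ | inj₂ G = inj₁ (transpose-grid G)
  ... | inj₂ sparse | inj₁ W | inj₁ T = inj₂ (begin
    ones (s * q) M
      ≡⟨ cong (λ n → ones n M) (*-comm s q) ⟩
    ones (q * s) M
      ≡⟨ ones-blocks M q ⟩
    ∑ q (λ a → ∑ q λ b → ones s (block M a b))
      ≤⟨ ∑-mono q (λ a _ → ∑-mono q λ b _ → block-bound M a b) ⟩
    ∑ q (λ a → ∑ q λ b → K * K * ind (contract M a b) + (s * s * ind (wide M a b) + s * s * ind (wide (flip M) b a)))
      ≡⟨ ∑-cong q (λ a _ → split a) ⟩
    ∑ q (λ a → K * K * # q (contract M a) + (s * s * # q (wide M a) + s * s * # q (λ b → wide (flip M) b a)))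
      ≡⟨ trans (∑-+ q _ _) (cong₂ _+_ (∑-*ˡ q (K * K) _) (trans (∑-+ q _ _) (cong₂ _+_ (∑-*ˡ q (s * s) _) (∑-*ˡ q (s * s) _)))) ⟩
    K * K * ones q (contract M) + (s * s * ones q (wide M) + s * s * ∑ q (λ a → # q (λ b → wide (flip M) b a)))
      ≡⟨ cong (λ z → K * K * ones q (contract M) + (s * s * z + s * s * ∑ q (λ a → # q (λ b → wide (flip M) b a)))) (∑-swap q q λ a b → ind (wide M a b)) ⟩
    K * K * ones q (contract M) + (s * s * ∑ q (λ b → # q (λ a → wide M a b)) + s * s * ∑ q (λ a → # q (λ b → wide (flip M) b a)))
      ≤⟨ +-mono-≤ (*-monoʳ-≤ (K * K) sparse) (+-mono-≤ (*-monoʳ-≤ (s * s) (∑-≤ q wideBound W)) (*-monoʳ-≤ (s * s) (∑-≤ q wideBound T))) ⟩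
    K * K * (density * q) + (s * s * (q * wideBound) + s * s * (q * wideBound))
      ≡⟨ total (K * K) (s * s) q wideBound ⟩
    density * (s * q) ∎)
    where
    open ≤-Reasoning
    q = s ^ e
    split : ∀ a → ∑ q (λ b → K * K * ind (contract M a b) + (s * s * ind (wide M a b) + s * s * ind (wide (flip M) b a)))
                ≡ K * K * # q (contract M a) + (s * s * # q (wide M a) + s * s * # q (λ b → wide (flip M) b a))
    split a = trans (∑-+ q _ _) (cong₂ _+_ (∑-*ˡ q (K * K) _) (trans (∑-+ q _ _) (cong₂ _+_ (∑-*ˡ q (s * s) _) (∑-*ˡ q (s * s) _))))
    total : ∀ k t q w → k * (2 * (t * w) * q) + (t * (q * w) + t * (q * w)) ≡ 2 * (t * w) * (suc k * q)
    total = solve 4 (λ k t q w → k :* (con 2 :* (t :* w) :* q) :+ (t :* (q :* w) :+ t :* (q :* w)) := con 2 :* (t :* w) :* ((con 1 :+ k) :* q)) refl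
      where open +-*-Solver

  power-above : ∀ N → 1 ≤ N → ∃ λ e → N ≤ s ^ e × s ^ e ≤ s * N
  power-above (suc zero)    _ = 0 , ≤-refl , s≤s z≤n
  power-above (suc (suc N)) _ with power-above (suc N) (s≤s z≤n)
  ... | e , lo , hi with suc (suc N) ≤? s ^ e
  ...   | yes p = e , p , ≤-trans hi (*-monoʳ-≤ s (n≤1+n _))
  ...   | no p  = suc e , above , *-monoʳ-≤ s (<⇒≤ (≰⇒> p))
    where
    open ≤-Reasoning
    above : suc (suc N) ≤ s * s ^ e
    above = begin
      suc (suc N)         ≤⟨ +-mono-≤ (s≤s {0} {N} z≤n) (≤-refl {suc N}) ⟩
      suc N + suc N       ≡⟨ cong (suc N +_) (+-identityʳ (suc N)) ⟨
      2 * suc N           ≤⟨ *-mono-≤ (s≤s (*-mono-≤ K≥1 K≥1)) lo ⟩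
      s * s ^ e           ∎

  -- Rounding N up to a power of s enlarges it at most s times, which costs the factor s in the
  -- threshold. The grid may use ones outside the N × N corner.
  dense⇒grid : ∀ M N → 1 ≤ N → density * s * N < ones N M → Grid K M
  dense⇒grid M N N≥1 dense with power-above N N≥1
  ... | e , lo , hi with grid-or-sparse e M
  ...   | inj₁ G = G
  ...   | inj₂ sparse = ⊥-elim (<⇒≱ dense (begin
    ones N M                       ≤⟨ ∑-mono N (λ i _ → ∑-monoˡ (ind ∘ M i) lo) ⟩
    ∑ N (λ i → # (s ^ e) (M i))    ≤⟨ ∑-monoˡ _ lo ⟩
    ones (s ^ e) M                 ≤⟨ sparse ⟩
    density * s ^ e                ≤⟨ *-monoʳ-≤ density hi ⟩
    density * (s * N)              ≡⟨ *-assoc density s N ⟨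
    density * s * N                ∎))
    where open ≤-Reasoning

ForcesGrid : ℕ → ℕ → Set
ForcesGrid K d = ∀ M N → 1 ≤ N → d * N < ones N M → Grid K M

-- Counting in lists without repetition, and splitting lists

sum-⊆ : ∀ {X : Set} (h : X → ℕ) {xs ys} → Unique xs →
  (∀ {x} → x ∈ xs → h x ≡ 0 ⊎ x ∈ ys) → sum (map h xs) ≤ sum (map h ys)
sum-⊆ h {[]} _ _ = z≤n
sum-⊆ h {x ∷ xs} {ys} (x≢ ∷ unique) cover with cover (here refl)
... | inj₁ hx≡0 rewrite hx≡0 = sum-⊆ h unique (cover ∘ there)
... | inj₂ x∈ys with ∈-∃++ x∈ys
...   | as , bs , refl = ≤-trans
  (+-monoʳ-≤ (h x) (sum-⊆ h unique cover′))
  (≤-reflexive (≡-sym (sum-↭ (map⁺ h (shift x as bs)))))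
  where
  cover′ : ∀ {y} → y ∈ xs → h y ≡ 0 ⊎ y ∈ as ++ bs
  cover′ y∈xs with cover (there y∈xs)
  ... | inj₁ hy≡0 = inj₁ hy≡0
  ... | inj₂ y∈ys with ∈-resp-↭ (shift x as bs) y∈ys
  ...   | here refl = ⊥-elim (All.lookup x≢ y∈xs refl)
  ...   | there y∈  = inj₂ y∈

sum-map-1 : ∀ {X : Set} (xs : List X) → sum (map (λ _ → 1) xs) ≡ length xs
sum-map-1 []       = refl
sum-map-1 (x ∷ xs) = cong suc (sum-map-1 xs)

length-⊆ : ∀ {X : Set} {xs ys : List X} → Unique xs → (∀ {x} → x ∈ xs → x ∈ ys) → length xs ≤ length ys
length-⊆ {xs = xs} {ys} unique xs⊆ys
  rewrite ≡-sym (sum-map-1 xs) | ≡-sym (sum-map-1 ys) = sum-⊆ _ unique (inj₂ ∘ xs⊆ys)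

length-Unique : ∀ {n} {xs : List (Fin n)} → Unique xs → length xs ≤ n
length-Unique {n} {xs} unique =
  subst (length xs ≤_) (length-tabulate {n = n} (λ i → i)) (length-⊆ unique λ {x} _ → ∈-allFin x)

length-concatMap : ∀ {X Y : Set} (f : X → List Y) xs → (∀ x → length (f x) ≤ 1) →
  length (concatMap f xs) ≤ length xs
length-concatMap f []       short = z≤n
length-concatMap f (x ∷ xs) short rewrite length-++ (f x) {concatMap f xs} =
  +-mono-≤ (short x) (length-concatMap f xs short)

Unique-++⁻ : ∀ {X : Set} (xs : List X) {ys} → Unique (xs ++ ys) →
  Unique xs × (∀ {x} → x ∈ xs → x ∉ ys)
Unique-++⁻ []       _             = [] , λ ()
Unique-++⁻ (x ∷ xs) (x≢ ∷ unique) with Unique-++⁻ xs unique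
... | unique′ , disjoint = All.++⁻ˡ xs x≢ ∷ unique′ , λ
  { (here refl) x∈ys → All.lookup (All.++⁻ʳ xs x≢) x∈ys refl ; (there x∈xs) → disjoint x∈xs }

last-satisfying : ∀ {X : Set} {Q : X → Set} → Decidable Q → ∀ {x} xs → x ∈ xs → Q x →
  ∃₂ λ as v → ∃ λ bs → xs ≡ as ++ v ∷ bs × Q v × (∀ {y} → y ∈ bs → ¬ Q y)
last-satisfying Q? (x ∷ xs) x∈ Qx with any? Q? xs
... | yes later with find later
...   | y , y∈xs , Qy with last-satisfying Q? xs y∈xs Qy
...     | as , v , bs , refl , rest = x ∷ as , v , bs , refl , rest
last-satisfying Q? (x ∷ xs) (here refl) Qx | no ¬later =
  [] , x , xs , refl , Qx , λ y∈xs Qy → ¬later (lose y∈xs Qy)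
last-satisfying Q? (x ∷ xs) (there x∈xs) Qx | no ¬later = ⊥-elim (¬later (lose x∈xs Qx))

-- As w is absent from ds, the cut at w is not later than the cut at v. Hence a rotation with pivot
-- w leaves the tail v ∷ ds in place.
split-suffix : ∀ {X : Set} as {w : X} {bs} cs {v ds} → as ++ w ∷ bs ≡ cs ++ v ∷ ds → w ∉ ds →
  ∃ λ es → w ∷ bs ≡ es ++ v ∷ ds
split-suffix []       cs       eq   w∉ds = cs , eq
split-suffix (a ∷ as) []       refl w∉ds = ⊥-elim (w∉ds (∈-++⁺ʳ as (here refl)))
split-suffix (a ∷ as) (c ∷ cs) eq   w∉ds = split-suffix as cs (proj₂ (∷-injective eq)) w∉ds

-- Consecutive elements of a list

data Consecutive {X : Set} (a b : X) : List X → Set where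
  here  : ∀ {l} → Consecutive a b (a ∷ b ∷ l)
  there : ∀ {x l} → Consecutive a b l → Consecutive a b (x ∷ l)

NextTo : ∀ {X : Set} → X → X → List X → Set
NextTo a b l = Consecutive a b l ⊎ Consecutive b a l

module _ {X : Set} where

  Consecutive-++⁺ˡ : ∀ {a b : X} {l} r → Consecutive a b l → Consecutive a b (l ++ r)
  Consecutive-++⁺ˡ r here      = here
  Consecutive-++⁺ˡ r (there c) = there (Consecutive-++⁺ˡ r c)

  Consecutive-++⁺ʳ : ∀ {a b : X} l {r} → Consecutive a b r → Consecutive a b (l ++ r)
  Consecutive-++⁺ʳ []      c = c
  Consecutive-++⁺ʳ (x ∷ l) c = there (Consecutive-++⁺ʳ l c)

  Consecutive⇒∈ : ∀ {a b x : X} {l} → Consecutive a b (x ∷ l) → b ∈ l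
  Consecutive⇒∈             here      = here refl
  Consecutive⇒∈ {l = _ ∷ _} (there c) = there (Consecutive⇒∈ c)

  Consecutive⇒∈ˡ : ∀ {a b : X} {l} → Consecutive a b l → a ∈ l
  Consecutive⇒∈ˡ here      = here refl
  Consecutive⇒∈ˡ (there c) = there (Consecutive⇒∈ˡ c)

  -- rotate as u bs is the path (u ∷ as) ++ bs with its initial segment u ∷ as reversed,
  -- split into its first vertex and the rest.
  rotate : List X → X → List X → X × List X
  rotate []       u bs = u , bs
  rotate (a ∷ as) u bs = rotate as a (u ∷ bs)

  toList : X × List X → List X
  toList (u , t) = u ∷ t

  -- Reversing the segment creates a single new adjacency, from u to the first element of bs: the
  -- case `here` of the left alternative.
  rotate-consecutive : ∀ as u bs {a b} → Consecutive a b (toList (rotate as u bs)) →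
    Consecutive a b (u ∷ bs) ⊎ Consecutive b a (u ∷ as)
  rotate-consecutive []       u bs c = inj₁ c
  rotate-consecutive (x ∷ as) u bs c with rotate-consecutive as x (u ∷ bs) c
  ... | inj₁ here       = inj₂ here
  ... | inj₁ (there c′) = inj₁ c′
  ... | inj₂ c′         = inj₂ (there c′)

  rotate-head : ∀ as u bs {w cs} → Consecutive (proj₁ (rotate as u bs)) w (u ∷ as ++ w ∷ cs)
  rotate-head []       u bs = here
  rotate-head (a ∷ as) u bs = there (rotate-head as a (u ∷ bs))

  rotate-↭ : ∀ as u bs → toList (rotate as u bs) ↭ u ∷ as ++ bs
  rotate-↭ []       u bs = ↭-refl
  rotate-↭ (a ∷ as) u bs = ↭-trans (rotate-↭ as a (u ∷ bs)) (shift u (a ∷ as) bs)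

  rotate-suffix : ∀ as u cs ds → ∃ λ es → proj₂ (rotate as u (cs ++ ds)) ≡ es ++ ds
  rotate-suffix []       u cs ds = cs , refl
  rotate-suffix (a ∷ as) u cs ds = rotate-suffix as a (u ∷ cs) ds

  rotate-nextTo : ∀ as u w bs {y x} → NextTo y x (toList (rotate as u (w ∷ bs))) →
    NextTo y x (u ∷ as ++ w ∷ bs) ⊎ y ≡ u ⊎ y ≡ w
  rotate-nextTo as u w bs (inj₁ c) with rotate-consecutive as u (w ∷ bs) c
  ... | inj₁ here       = inj₂ (inj₁ refl)
  ... | inj₁ (there c′) = inj₁ (inj₁ (Consecutive-++⁺ʳ (u ∷ as) c′))
  ... | inj₂ c′         = inj₁ (inj₂ (Consecutive-++⁺ˡ (w ∷ bs) c′))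
  rotate-nextTo as u w bs (inj₂ c) with rotate-consecutive as u (w ∷ bs) c
  ... | inj₁ here       = inj₂ (inj₂ refl)
  ... | inj₁ (there c′) = inj₁ (inj₂ (Consecutive-++⁺ʳ (u ∷ as) c′))
  ... | inj₂ c′         = inj₁ (inj₁ (Consecutive-++⁺ˡ (w ∷ bs) c′))

module _ {n : ℕ} where

  open import Data.List.Membership.DecPropositional (Fin._≟_ {n}) using (_∈?_) public

  -- Successor and predecessor of r on the path a ∷ l, as lists with at most one element, so that
  -- `concatMap` gathers them over all ends.
  after before : Fin n → Fin n → List (Fin n) → List (Fin n)
  after r a []    = []
  after r a (b ∷ l) with r Fin.≟ a
  ... | yes _ = [ b ]
  ... | no _  = after r b l
  before r a []    = []
  before r a (b ∷ l) with r Fin.≟ b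
  ... | yes _ = [ a ]
  ... | no _  = before r b l

  length-after : ∀ a l r → length (after r a l) ≤ 1
  length-after a []    r = z≤n
  length-after a (b ∷ l) r with r Fin.≟ a
  ... | yes _ = ≤-refl
  ... | no _  = length-after b l r

  length-before : ∀ a l r → length (before r a l) ≤ 1
  length-before a []    r = z≤n
  length-before a (b ∷ l) r with r Fin.≟ b
  ... | yes _ = ≤-refl
  ... | no _  = length-before b l r

  ∈-after : ∀ {r y} a l → Unique (a ∷ l) → Consecutive r y (a ∷ l) → y ∈ after r a l
  ∈-after     a []    _             (there ())
  ∈-after {r} a (b ∷ l) (a≢ ∷ unique) c with r Fin.≟ a | c
  ... | yes _    | here     = here refl
  ... | yes refl | there c′ = ⊥-elim (All.lookup a≢ (Consecutive⇒∈ˡ c′) refl)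
  ... | no r≢a   | here     = ⊥-elim (r≢a refl)
  ... | no _     | there c′ = ∈-after b l unique c′

  ∈-before : ∀ {r y} a l → Unique (a ∷ l) → Consecutive y r (a ∷ l) → y ∈ before r a l
  ∈-before     a []    _             (there ())
  ∈-before {r} a (b ∷ l) (a≢ ∷ unique) c with r Fin.≟ b | c
  ... | yes _    | here     = here refl
  ... | yes refl | there c′ = ⊥-elim (Unique[x∷xs]⇒x∉xs unique (Consecutive⇒∈ c′))
  ... | no r≢b   | here     = ⊥-elim (r≢b refl)
  ... | no _     | there c′ = ∈-before b l unique c′

  -- Pósa rotations

  module Posa (G : Graph n) where

    V : Set
    V = Fin n

    _~_ : V → V → Set
    u ~ v = adj G u v ≡ true

    ~-sym : ∀ {u v} → u ~ v → v ~ u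
    ~-sym {u} {v} u~v = trans (Graph.sym G v u) u~v

    ~-irrefl : ∀ {v} → ¬ v ~ v
    ~-irrefl {v} v~v with trans (≡-sym v~v) (irrefl G v)
    ... | ()

    _~?_ : ∀ u v → Dec (u ~ v)
    u ~? v = adj G u v Bool.≟ true

    -- The first component is the free end; the fixed end is the last vertex of the path.
    Path : Set
    Path = V × List V

    record IsPath (p : List V) : Set where
      field
        unique : Unique p
        linked : ∀ {a b} → Consecutive a b p → a ~ b
    open IsPath

    -- If `as` is empty, the pivot w already follows u and the path stays as it is. Admitting this
    -- trivial rotation lets `Closed` treat all neighbours of u alike.
    data Rotation : Path → Path → Set where
      rot : ∀ u as w bs → u ~ w → Rotation (u , as ++ w ∷ bs) (rotate as u (w ∷ bs))

    rotation-↭ : ∀ {p q} → Rotation p q → toList q ↭ toList p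
    rotation-↭ (rot u as w bs _) = rotate-↭ as u (w ∷ bs)

    rotation-isPath : ∀ {p q} → Rotation p q → IsPath (toList p) → IsPath (toList q)
    rotation-isPath ρ isPath .unique =
      ↭ₛ.Unique-resp-↭ (setoid V) (↭⇒↭ₛ (↭-sym (rotation-↭ ρ))) (isPath .unique)
    rotation-isPath (rot u as w bs u~w) isPath .linked c with rotate-consecutive as u (w ∷ bs) c
    ... | inj₁ here       = u~w
    ... | inj₁ (there c′) = isPath .linked (Consecutive-++⁺ʳ (u ∷ as) c′)
    ... | inj₂ c′         = ~-sym (isPath .linked (Consecutive-++⁺ˡ (w ∷ bs) c′))

    data History (p₀ : Path) : List Path → Set where
      start : History p₀ (p₀ ∷ [])
      step  : ∀ {ps p q} → History p₀ ps → p ∈ ps → Rotation p q → History p₀ (q ∷ ps)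

    ends : List Path → List V
    ends = map proj₁

    module _ {p₀ : Path} where

      history-↭ : ∀ {ps p} → History p₀ ps → p ∈ ps → toList p ↭ toList p₀
      history-↭ start           (here refl) = ↭-refl
      history-↭ (step h p∈ ρ)   (here refl) = ↭-trans (rotation-↭ ρ) (history-↭ h p∈)
      history-↭ (step h _ _)    (there q∈)  = history-↭ h q∈

      history-isPath : ∀ {ps p} → IsPath (toList p₀) → History p₀ ps → p ∈ ps → IsPath (toList p)
      history-isPath isP start         (here refl) = isP
      history-isPath isP (step h p∈ ρ) (here refl) = rotation-isPath ρ (history-isPath isP h p∈)
      history-isPath isP (step h _ _)  (there q∈)  = history-isPath isP h q∈

      -- A pivot of a rotation is in U because, up to then, its path-neighbours are those in p₀
      -- and one of them becomes an end; so vertices outside U never change path-neighbours.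
      history-nextTo : ∀ {U R : List V} → (∀ {r} → r ∈ R → r ∈ U) →
        (∀ {r y} → r ∈ R → NextTo y r (toList p₀) → y ∈ U) →
        ∀ {ps} → History p₀ ps → (∀ {r} → r ∈ ends ps → r ∈ R) →
        ∀ {p x y} → p ∈ ps → y ∉ U → NextTo y x (toList p) → NextTo y x (toList p₀)
      history-nextTo R⊆U nbrs⊆U start _ (here refl) y∉U next = next
      history-nextTo R⊆U nbrs⊆U (step h _ _) ends⊆R (there q∈) y∉U next =
        history-nextTo R⊆U nbrs⊆U h (ends⊆R ∘ there) q∈ y∉U next
      history-nextTo R⊆U nbrs⊆U (step h p∈ (rot u as w bs _)) ends⊆R (here refl) y∉U next
        with rotate-nextTo as u w bs next
      ... | inj₁ next′       = history-nextTo R⊆U nbrs⊆U h (ends⊆R ∘ there) p∈ y∉U next′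
      ... | inj₂ (inj₁ refl) = ⊥-elim (y∉U (R⊆U (ends⊆R (there (∈-map⁺ proj₁ p∈)))))
      ... | inj₂ (inj₂ refl) = ⊥-elim (y∉U (nbrs⊆U (ends⊆R (here refl))
        (history-nextTo R⊆U nbrs⊆U h (ends⊆R ∘ there) p∈ y∉U (inj₂ (rotate-head as u (w ∷ bs))))))

      -- Every pivot is adjacent to an end in R, so it is not in ds and lies at v or earlier; the
      -- reversed segment stops before the pivot.
      history-suffix : ∀ {R : List V} {v ds cs} → proj₂ p₀ ≡ cs ++ v ∷ ds →
        (∀ {u w} → u ∈ R → u ~ w → w ∉ ds) →
        ∀ {ps} → History p₀ ps → (∀ {r} → r ∈ ends ps → r ∈ R) →
        ∀ {p} → p ∈ ps → ∃ λ es → proj₂ p ≡ es ++ v ∷ ds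
      history-suffix eq avoid start ends⊆R (here refl) = _ , eq
      history-suffix eq avoid (step h _ _) ends⊆R (there q∈) =
        history-suffix eq avoid h (ends⊆R ∘ there) q∈
      history-suffix eq avoid (step h p∈ (rot u as w bs u~w)) ends⊆R (here refl)
        with history-suffix eq avoid h (ends⊆R ∘ there) p∈
      ... | es , eq′ with split-suffix as es eq′ (avoid (ends⊆R (there (∈-map⁺ proj₁ p∈))) u~w)
      ...   | fs , eq″ rewrite eq″ = rotate-suffix as u fs _

    -- Two conditions in one: every neighbour w of a free end lies on the path, and the end that a
    -- rotation with pivot w would produce, the predecessor z of w, is already recorded.
    Closed : List Path → Set
    Closed ps = ∀ {p} → p ∈ ps → ∀ {w} → proj₁ p ~ w →
      ∃ λ z → Consecutive z w (toList p) × z ∈ ends ps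

    record Saturated : Set where
      field
        p₀          : Path
        isPath      : IsPath (toList p₀)
        ps          : List Path
        history     : History p₀ ps
        ends-unique : Unique (ends ps)
        closed      : Closed ps

    Escape : List Path → Set
    Escape ps = ∃₂ λ p w → p ∈ ps × w ~ proj₁ p × w ∉ toList p

    Fresh : List Path → Set
    Fresh ps = ∃₂ λ p q → p ∈ ps × Rotation p q × proj₁ q ∉ ends ps

    closed-or : ∀ ps → Closed ps ⊎ (Escape ps ⊎ Fresh ps)
    closed-or ps = map₁ (λ good p∈ {w} → good p∈ (∈-allFin w))
      (all-or ps λ {p} p∈ → all-or (allFin n) λ {w} _ → try p p∈ w)
      where
      try : ∀ p → p ∈ ps → ∀ w →
        (proj₁ p ~ w → ∃ λ z → Consecutive z w (toList p) × z ∈ ends ps) ⊎ (Escape ps ⊎ Fresh ps)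
      try (u , t) p∈ w with u ~? w
      ... | no u≁w  = inj₁ (⊥-elim ∘ u≁w)
      ... | yes u~w with w ∈? t
      ...   | no w∉t = inj₂ (inj₁ ((u , t) , w , p∈ , ~-sym u~w , λ
        { (here refl) → ~-irrefl u~w ; (there w∈t) → w∉t w∈t }))
      ...   | yes w∈t with ∈-∃++ w∈t
      ...     | as , bs , refl with proj₁ (rotate as u (w ∷ bs)) ∈? ends ps
      ...       | yes z∈ = inj₁ λ _ → _ , rotate-head as u (w ∷ bs) , z∈
      ...       | no z∉  = inj₂ (inj₂ (_ , _ , p∈ , rot u as w bs u~w , z∉))

    cons-isPath : ∀ {w p} → IsPath (toList p) → w ~ proj₁ p → w ∉ toList p → IsPath (w ∷ toList p)
    cons-isPath isP w~u w∉p .unique = All.¬Any⇒All¬ _ w∉p ∷ isP .unique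
    cons-isPath isP w~u w∉p .linked here      = w~u
    cons-isPath isP w~u w∉p .linked (there c) = isP .linked c

    -- A fresh end enlarges a set of at most n distinct ends, so `fuel` suffices. An escape discards
    -- the history and hands a path with one more vertex to `longer`; this continuation separates
    -- the induction on the number of ends from the outer one on the length of the path.
    saturate : ∀ p₀ → IsPath (toList p₀) →
      (∀ q → IsPath (toList q) → length (toList q) ≡ suc (length (toList p₀)) → Saturated) →
      ∀ fuel ps → History p₀ ps → Unique (ends ps) → n ≤ length (ends ps) + fuel → Saturated
    saturate p₀ isP longer fuel ps h unique-ends bound with closed-or ps
    ... | inj₁ closed = record
      { p₀ = p₀ ; isPath = isP ; ps = ps ; history = h ; ends-unique = unique-ends ; closed = closed }
    ... | inj₂ (inj₁ (p , w , p∈ , w~u , w∉p)) =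
      longer (w , toList p) (cons-isPath (history-isPath isP h p∈) w~u w∉p)
        (cong suc (↭-length (history-↭ h p∈)))
    saturate p₀ isP longer zero ps h unique-ends bound | inj₂ (inj₂ (p , q , p∈ , ρ , z∉)) =
      ⊥-elim (<⇒≱ (length-Unique {xs = proj₁ q ∷ ends ps} (All.¬Any⇒All¬ _ z∉ ∷ unique-ends))
        (subst (n ≤_) (+-identityʳ _) bound))
    saturate p₀ isP longer (suc fuel) ps h unique-ends bound | inj₂ (inj₂ (p , q , p∈ , ρ , z∉)) =
      saturate p₀ isP longer fuel (q ∷ ps) (step h p∈ ρ) (All.¬Any⇒All¬ _ z∉ ∷ unique-ends)
        (subst (n ≤_) (+-suc _ fuel) bound)

    extend : ∀ fuel p → IsPath (toList p) → n ≤ length (toList p) + fuel → Saturated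
    extend fuel p isP bound =
      saturate p isP (longer fuel bound) n (p ∷ []) start ([] ∷ []) (m≤n+m n 1)
      where
      longer : ∀ fuel → n ≤ length (toList p) + fuel → ∀ q → IsPath (toList q) →
        length (toList q) ≡ suc (length (toList p)) → Saturated
      longer zero bound q isQ eq = ⊥-elim (<⇒≱ (subst (_≤ n) eq (length-Unique (isQ .unique)))
        (subst (n ≤_) (+-identityʳ _) bound))
      longer (suc fuel) bound q isQ eq =
        extend fuel q isQ (subst (n ≤_) (trans (+-suc _ fuel) (≡-sym (cong (_+ fuel) eq))) bound)

    saturated : V → Saturated
    saturated v = extend n (v , []) record { unique = [] ∷ [] ; linked = λ { (there ()) } } (m≤n+m n 1)

    record DenseCycle : Set where
      field
        first last : V
        middle     : List V
      cycle : List V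
      cycle = first ∷ middle ++ [ last ]
      field
        isPath  : IsPath cycle
        closing : last ~ first
        R U     : List V
        R-unique : Unique R
        R-nonempty : 1 ≤ length R
        |U|≤3|R| : length U ≤ 3 * length R
        R⊆cycle : ∀ {u} → u ∈ R → u ∈ cycle
        R⊆U     : ∀ {u} → u ∈ R → u ∈ U
        N⊆cycle : ∀ {u w} → u ∈ R → u ~ w → w ∈ cycle
        N⊆U     : ∀ {u w} → u ∈ R → u ~ w → w ∈ U

    -- The dense cycle of a saturated path

    module _ (sat : Saturated) where

      open Saturated sat renaming (isPath to isPath₀)

      private
        R = ends ps
        u₀ = proj₁ p₀
        t₀ = proj₂ p₀
        P : List V
        P = u₀ ∷ t₀

      Near : V → Set
      Near w = Any (_~ w) R

      surroundings : List V
      surroundings = R ++ (concatMap (λ r → after r u₀ t₀) R ++ concatMap (λ r → before r u₀ t₀) R)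

      length-surroundings : length surroundings ≤ 3 * length R
      length-surroundings = begin
        length surroundings
          ≡⟨ trans (length-++ R) (cong (length R +_) (length-++ (concatMap (λ r → after r u₀ t₀) R))) ⟩
        length R + (length (concatMap (λ r → after r u₀ t₀) R) + length (concatMap (λ r → before r u₀ t₀) R))
          ≤⟨ +-monoʳ-≤ (length R) (+-mono-≤ (length-concatMap _ R (length-after u₀ t₀)) (length-concatMap _ R (length-before u₀ t₀))) ⟩
        length R + (length R + length R)
          ≡⟨ cong (λ m → length R + (length R + m)) (+-identityʳ (length R)) ⟨
        3 * length R ∎
        where open ≤-Reasoning

      nextTo⊆surroundings : ∀ {r y} → r ∈ R → NextTo y r P → y ∈ surroundings
      nextTo⊆surroundings r∈ (inj₁ c) = ∈-++⁺ʳ R (∈-++⁺ʳ (concatMap (λ r → after r u₀ t₀) R)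
        (∈-concatMap⁺ _ (lose r∈ (∈-before u₀ t₀ (isPath₀ .unique) c))))
      nextTo⊆surroundings r∈ (inj₂ c) = ∈-++⁺ʳ R (∈-++⁺ˡ
        (∈-concatMap⁺ _ (lose r∈ (∈-after u₀ t₀ (isPath₀ .unique) c))))

      -- Pósa's argument: let r be the free end of p. The predecessor z of w on p is an end, as the
      -- history is closed. If w were outside the set, its path-neighbours on p would be
      -- path-neighbours on the original path; so w would be next to z ∈ R there, which puts it into
      -- the set.
      neighbours⊆surroundings : ∀ {r w} → r ∈ R → r ~ w → w ∈ surroundings
      neighbours⊆surroundings {w = w} r∈ r~w with w ∈? surroundings
      ... | yes w∈ = w∈
      ... | no w∉ with ∈-map⁻ proj₁ r∈
      ...   | p , p∈ , refl with closed p∈ r~w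
      ...     | z , c , z∈ = nextTo⊆surroundings z∈
        (history-nextTo ∈-++⁺ˡ nextTo⊆surroundings history (λ r∈ → r∈) p∈ w∉ (inj₂ c))

      p₀∈ : ∀ {p₀ ps} → History p₀ ps → p₀ ∈ ps
      p₀∈ start        = here refl
      p₀∈ (step h _ _) = there (p₀∈ h)

      ends⊆path : ∀ {r} → r ∈ R → r ∈ P
      ends⊆path r∈ with ∈-map⁻ proj₁ r∈
      ... | q , q∈ , refl = ∈-resp-↭ (history-↭ history q∈) (here refl)

      neighbours⊆path : ∀ {r w} → r ∈ R → r ~ w → w ∈ P
      neighbours⊆path r∈ r~w with ∈-map⁻ proj₁ r∈
      ... | q , q∈ , refl with closed q∈ r~w
      ...   | _ , c , _ = ∈-resp-↭ (history-↭ history q∈) (there (Consecutive⇒∈ c))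

      module _ {v : V} {cs ds : List V} (p₀-eq : t₀ ≡ cs ++ v ∷ ds) (far : ∀ {y} → y ∈ ds → ¬ Near y) where

        suffix : ∀ {p} → p ∈ ps → ∃ λ es → proj₂ p ≡ es ++ v ∷ ds
        suffix = history-suffix p₀-eq (λ u∈ u~w w∈ → far w∈ (lose u∈ u~w)) history (λ r∈ → r∈)

        -- Every recorded path still has the tail v ∷ ds, and its free end does not reappear later
        -- on it.
        ends-avoid : ∀ {r} → r ∈ R → r ∉ ds
        ends-avoid r∈ r∈ds with ∈-map⁻ proj₁ r∈
        ... | q , q∈ , refl with suffix q∈
        ...   | es , eq = Unique[x∷xs]⇒x∉xs (history-isPath isPath₀ history q∈ .unique)
          (subst (proj₁ q ∈_) (≡-sym eq) (∈-++⁺ʳ es (there r∈ds)))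

        -- The edge from the free end to v closes the path once ds is cut off; this loses nothing,
        -- because ds contains neither an end nor a neighbour of one.
        closeUp : ∀ {p} → p ∈ ps → proj₁ p ~ v → DenseCycle
        closeUp {u , t} p∈ u~v with suffix p∈
        ... | es , refl = record
          { first = u ; last = v ; middle = es
          ; isPath = record
            { unique = proj₁ (Unique-++⁻ cyc (subst Unique cyc-eq (isP .unique)))
            ; linked = λ c → isP .linked (subst (Consecutive _ _) (≡-sym cyc-eq) (Consecutive-++⁺ˡ ds c)) }
          ; closing = ~-sym u~v
          ; R = R ; U = surroundings ; R-unique = ends-unique
          ; R-nonempty = ∈-length (∈-map⁺ proj₁ p∈)
          ; |U|≤3|R| = length-surroundings
          ; R⊆cycle = λ r∈ → path∖ds⊆cyc (ends⊆path r∈) (ends-avoid r∈)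
          ; R⊆U = ∈-++⁺ˡ
          ; N⊆cycle = λ r∈ r~w → path∖ds⊆cyc (neighbours⊆path r∈ r~w) (λ w∈ → far w∈ (lose r∈ r~w))
          ; N⊆U = neighbours⊆surroundings }
          where
          cyc = u ∷ es ++ [ v ]
          isP = history-isPath isPath₀ history p∈

          cyc-eq : u ∷ es ++ v ∷ ds ≡ cyc ++ ds
          cyc-eq = cong (u ∷_) (≡-sym (++-assoc es [ v ] ds))

          path∖ds⊆cyc : ∀ {w} → w ∈ P → w ∉ ds → w ∈ cyc
          path∖ds⊆cyc {w} w∈P w∉ds
            with ∈-++⁻ cyc (subst (w ∈_) cyc-eq (∈-resp-↭ (↭-sym (history-↭ history p∈)) w∈P))
          ... | inj₁ w∈cyc = w∈cyc
          ... | inj₂ w∈ds  = ⊥-elim (w∉ds w∈ds)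

      -- The cycle closes at the last vertex of the path that is adjacent to an end of a rotated
      -- path: no rotation ever moves anything beyond it.
      saturated⇒denseCycle : (∃ λ w → u₀ ~ w) → DenseCycle
      saturated⇒denseCycle (w , u₀~w) with closed (p₀∈ history) u₀~w
      ... | _ , c , _ with last-satisfying (λ w → any? (_~? w) R) t₀ (Consecutive⇒∈ c)
                             (lose (∈-map⁺ proj₁ (p₀∈ history)) u₀~w)
      ...   | cs , v , ds , eq , near , far with find near
      ...     | u , u∈R , u~v with ∈-map⁻ proj₁ u∈R
      ...       | p , p∈ , refl = closeUp eq far p∈ u~v

    denseCycle : V → (∀ u → ∃ λ w → u ~ w) → DenseCycle
    denseCycle v neighbour = saturated⇒denseCycle sat (neighbour (proj₁ (Saturated.p₀ sat)))
      where sat = saturated v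

-- From a labelled cycle to a model of K′

next-toℕ : ∀ {m} (i : Fin m) → suc (toℕ i) < m → toℕ (next i) ≡ suc (toℕ i)
next-toℕ {suc k} i 1+i<m with suc (toℕ i) <? suc k
... | yes p = toℕ-fromℕ< p
... | no ¬p = ⊥-elim (¬p 1+i<m)

next-wrap : ∀ {m} (i : Fin m) → ¬ suc (toℕ i) < m → toℕ (next i) ≡ 0
next-wrap {suc k} i ¬1+i<m with suc (toℕ i) <? suc k
... | yes p = ⊥-elim (¬1+i<m p)
... | no _  = refl

iter-next : ∀ {m} t (i : Fin m) → toℕ i + t < m → toℕ (iter t next i) ≡ toℕ i + t
iter-next zero    i _ = ≡-sym (+-identityʳ (toℕ i))
iter-next (suc t) i bound rewrite +-suc (toℕ i) t =
  trans (next-toℕ (iter t next i) (subst (λ x → suc x < _) (≡-sym ih) bound)) (cong suc ih)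
  where ih = iter-next t i (<⇒≤ bound)

monotone-crossing : ∀ {F} → Mono F → ∀ {x} d p → F p ≡ x → F (p + d) ≡ suc x →
  ∃ λ r → r < p + d × F r ≡ x × F (suc r) ≡ suc x
monotone-crossing mono zero p Fp Fq rewrite +-identityʳ p = ⊥-elim (1+n≢n (trans (≡-sym Fq) Fp))
monotone-crossing {F} mono {x} (suc d) p Fp Fq rewrite +-suc p d with F (suc p) ≤? x
... | yes le = monotone-crossing mono d (suc p)
  (≤-antisym le (subst (_≤ F (suc p)) Fp (mono (n≤1+n p)))) Fq
... | no ¬le = p , s≤s (m≤m+n p d) , Fp ,
  ≤-antisym (subst (F (suc p) ≤_) Fq (mono (s≤s (m≤m+n p d)))) (≰⇒> ¬le)

<ᵇ-true : ∀ {a b} → a < b → (a <ᵇ b) ≡ true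
<ᵇ-true a<b = Equivalence.to T-≡ (<⇒<ᵇ a<b)

<ᵇ-true⁻ : ∀ {a b} → (a <ᵇ b) ≡ true → a < b
<ᵇ-true⁻ {a} {b} eq = <ᵇ⇒< a b (Equivalence.from T-≡ eq)

<ᵇ-false : ∀ {a b} → b ≤ a → (a <ᵇ b) ≡ false
<ᵇ-false {a} {b} b≤a with a <ᵇ b in eq
... | true  = ⊥-elim (<⇒≱ (<ᵇ-true⁻ eq) b≤a)
... | false = refl

<ᵇ-false⁻ : ∀ {a b} → (a <ᵇ b) ≡ false → b ≤ a
<ᵇ-false⁻ {a} {b} eq with a <? b
... | no a≮b  = ≮⇒≥ a≮b
... | yes a<b = ⊥-elim (subst T eq (<⇒<ᵇ a<b))

module _ (ℓ : ℕ) where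

  opposite : Fin (ℓ + ℓ) → Fin (ℓ + ℓ) → Bool
  opposite x y = (toℕ x <ᵇ ℓ) xor (toℕ y <ᵇ ℓ)

  opposite⁻ : ∀ x y → opposite x y ≡ true → (toℕ x < ℓ × ℓ ≤ toℕ y) ⊎ (ℓ ≤ toℕ x × toℕ y < ℓ)
  opposite⁻ x y eq with toℕ x <ᵇ ℓ in x-eq | toℕ y <ᵇ ℓ in y-eq
  ... | true  | false = inj₁ (<ᵇ-true⁻ x-eq , <ᵇ-false⁻ y-eq)
  ... | false | true  = inj₂ (<ᵇ-false⁻ x-eq , <ᵇ-true⁻ y-eq)

  K′-opposite : ∀ x y → opposite x y ≡ true → K′ ℓ x y ≡ true
  K′-opposite x y eq rewrite eq = refl

  K′-suc : ∀ x y → suc (toℕ x) ≡ toℕ y → K′ ℓ x y ≡ true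
  K′-suc x y eq with opposite x y
  ... | true  = refl
  ... | false rewrite Equivalence.to T-≡ (≡⇒≡ᵇ (suc (toℕ x)) (toℕ y) eq) = refl

  K′-sym : ∀ x y → K′ ℓ x y ≡ K′ ℓ y x
  K′-sym x y rewrite xor-comm (toℕ x <ᵇ ℓ) (toℕ y <ᵇ ℓ)
                   | ∨-comm (suc (toℕ x) ≡ᵇ toℕ y) (suc (toℕ y) ≡ᵇ toℕ x) = refl

  K′⁻ : ∀ x y → K′ ℓ x y ≡ true →
    opposite x y ≡ true ⊎ suc (toℕ x) ≡ toℕ y ⊎ suc (toℕ y) ≡ toℕ x
  K′⁻ x y eq with opposite x y | suc (toℕ x) ≡ᵇ toℕ y in xy | suc (toℕ y) ≡ᵇ toℕ x in yx
  ... | true  | _    | _    = inj₁ refl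
  ... | false | true | _    = inj₂ (inj₁ (≡ᵇ⇒≡ _ _ (Equivalence.from T-≡ xy)))
  ... | false | false | true = inj₂ (inj₂ (≡ᵇ⇒≡ _ _ (Equivalence.from T-≡ yx)))

  -- F labels the positions along the cycle, labels below ℓ being side A. Monotonicity makes its
  -- fibres arcs; `chord` supplies the edges between the sides and also shows that every label
  -- occurs.
  module Contraction {n : ℕ} (G : Graph n) {m : ℕ} (m≥3 : 3 ≤ m)
    (c : Fin m → Fin n) (c-inj : ∀ {i j} → c i ≡ c j → i ≡ j)
    (cyclic : ∀ i → adj G (c i) (c (next i)) ≡ true)
    (ℓ≥1 : 1 ≤ ℓ) (F : ℕ → ℕ) (F-mono : Mono F) (F<2ℓ : ∀ p → F p < ℓ + ℓ)
    (chord : ∀ {a b} → a < ℓ → b < ℓ →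
      ∃₂ λ i j → F (toℕ i) ≡ a × F (toℕ j) ≡ ℓ + b × adj G (c i) (c j) ≡ true)
    where

    φ : Fin m → Fin (ℓ + ℓ)
    φ i = fromℕ< (F<2ℓ (toℕ i))

    toℕ-φ : ∀ i → toℕ (φ i) ≡ F (toℕ i)
    toℕ-φ i = toℕ-fromℕ< (F<2ℓ (toℕ i))

    φ-≡ : ∀ {i x} → F (toℕ i) ≡ toℕ x → φ i ≡ x
    φ-≡ {i} eq = toℕ-injective (trans (toℕ-φ i) eq)

    -- Every label occurs at an end of a chord; as ℓ ≥ 1, index 0 on the other side can serve as
    -- partner.
    F-surj : ∀ {x} → x < ℓ + ℓ → ∃ λ i → F (toℕ i) ≡ x
    F-surj {x} x<2ℓ with x <? ℓ
    ... | yes x<ℓ with chord x<ℓ ℓ≥1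
    ...   | i , _ , Fi , _ = i , Fi
    F-surj {x} x<2ℓ | no x≮ℓ with chord ℓ≥1 (+-cancelˡ-< ℓ _ _ (subst (_< ℓ + ℓ) (≡-sym (m+[n∸m]≡n (≮⇒≥ x≮ℓ))) x<2ℓ))
    ...   | _ , j , _ , Fj , _ = j , trans Fj (m+[n∸m]≡n (≮⇒≥ x≮ℓ))

    -- A label skipped between two consecutive positions could occur nowhere, as F is monotone.
    F-suc : ∀ p → suc p < m → F (suc p) ≤ suc (F p)
    F-suc p 1+p<m with F (suc p) ≤? suc (F p)
    ... | yes le = le
    ... | no ¬le with F-surj (<-trans (≰⇒> ¬le) (F<2ℓ (suc p)))
    ...   | i , Fi with toℕ i ≤? p
    ...     | yes i≤p = ⊥-elim (1+n≰n (subst (_≤ F p) Fi (F-mono i≤p)))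
    ...     | no i≰p  = ⊥-elim (¬le (subst (F (suc p) ≤_) Fi (F-mono (≰⇒> i≰p))))

    F-crossing : ∀ {x} → suc x < ℓ + ℓ → ∃ λ i → F (toℕ i) ≡ x × F (toℕ (next i)) ≡ suc x
    F-crossing {x} 1+x<2ℓ with F-surj (<-trans (n<1+n x) 1+x<2ℓ) | F-surj 1+x<2ℓ
    ... | i , Fi | j , Fj with toℕ j ≤? toℕ i
    ...   | yes j≤i = ⊥-elim (1+n≰n (subst (_≤ x) Fj (subst (F (toℕ j) ≤_) Fi (F-mono j≤i))))
    ...   | no j≰i with monotone-crossing F-mono (toℕ j ∸ toℕ i) (toℕ i) Fi (trans (cong F q-eq) Fj)
      where q-eq = m+[n∸m]≡n (<⇒≤ (≰⇒> j≰i))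
    ...     | r , r<q , Fr , F1+r = fromℕ< r<m ,
      trans (cong F (toℕ-fromℕ< r<m)) Fr ,
      trans (cong F (trans (next-toℕ (fromℕ< r<m) 1+r<m′) (cong suc (toℕ-fromℕ< r<m)))) F1+r
      where
      1+r<m : suc r < m
      1+r<m = ≤-<-trans (subst (r <_) (m+[n∸m]≡n (<⇒≤ (≰⇒> j≰i))) r<q) (toℕ<n j)
      r<m = <⇒≤ 1+r<m
      1+r<m′ : suc (toℕ (fromℕ< r<m)) < m
      1+r<m′ = subst (λ x → suc x < m) (≡-sym (toℕ-fromℕ< r<m)) 1+r<m

    isNext : Fin m → Fin m → Bool
    isNext i j = does (next i Fin.≟ j)

    isNext⁻ : ∀ i j → isNext i j ≡ true → next i ≡ j
    isNext⁻ i j eq with next i Fin.≟ j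
    isNext⁻ i j eq | yes p = p

    -- Chords within a side are left out, since they could join branch sets that are not adjacent in
    -- K′, and the minor has to be K′ exactly.
    S : Fin m → Fin m → Bool
    S i j = adj G (c i) (c j) ∧ ((isNext i j ∨ isNext j i) ∨ opposite (φ i) (φ j))

    S-sym : ∀ i j → S i j ≡ S j i
    S-sym i j rewrite Graph.sym G (c i) (c j) | ∨-comm (isNext i j) (isNext j i)
                    | xor-comm (toℕ (φ i) <ᵇ ℓ) (toℕ (φ j) <ᵇ ℓ) = refl

    S⊆G : ∀ i j → S i j ≡ true → adj G (c i) (c j) ≡ true
    S⊆G i j eq with adj G (c i) (c j)
    ... | true = refl

    S-next : ∀ i → S i (next i) ≡ true
    S-next i rewrite cyclic i | dec-true (next i Fin.≟ next i) refl = refl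

    S-opposite : ∀ i j → adj G (c i) (c j) ≡ true → opposite (φ i) (φ j) ≡ true → S i j ≡ true
    S-opposite i j ij opp rewrite ij | opp = ∨-zeroʳ (isNext i j ∨ isNext j i)

    S⁻ : ∀ i j → S i j ≡ true → opposite (φ i) (φ j) ≡ true ⊎ next i ≡ j ⊎ next j ≡ i
    S⁻ i j eq with adj G (c i) (c j) | isNext i j in ij | isNext j i in ji | opposite (φ i) (φ j)
    ... | _    | _     | _     | true  = inj₁ refl
    ... | true | true  | _     | false = inj₂ (inj₁ (isNext⁻ i j ij))
    ... | true | false | true  | false = inj₂ (inj₂ (isNext⁻ j i ji))

    -- Along the cycle a changing label rises by exactly one. The closing edge leads from a label at
    -- least ℓ back to one below ℓ, so it joins the two sides.
    K′-next : ∀ i → φ i ≢ φ (next i) → K′ ℓ (φ i) (φ (next i)) ≡ true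
    K′-next i φi≢ with suc (toℕ i) <? m
    ... | yes 1+i<m = K′-suc (φ i) (φ (next i)) (≡-sym (≤-antisym upper lower))
      where
      eq : toℕ (φ (next i)) ≡ F (suc (toℕ i))
      eq = trans (toℕ-φ (next i)) (cong F (next-toℕ i 1+i<m))
      upper : toℕ (φ (next i)) ≤ suc (toℕ (φ i))
      upper rewrite eq | toℕ-φ i = F-suc (toℕ i) 1+i<m
      lower : suc (toℕ (φ i)) ≤ toℕ (φ (next i))
      lower = ≤∧≢⇒< (subst (_≤ toℕ (φ (next i))) (≡-sym (toℕ-φ i)) (subst (F (toℕ i) ≤_) (≡-sym eq) (F-mono (n≤1+n _)))) (φi≢ ∘ toℕ-injective)
    ... | no 1+i≮m with chord ℓ≥1 ℓ≥1
    ...   | i₀ , j₀ , Fi₀ , Fj₀ , _ = K′-opposite (φ i) (φ (next i)) opp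
      where
      i-right : ℓ ≤ toℕ (φ i)
      i-right rewrite toℕ-φ i = ≤-trans (≤-trans (m≤m+n ℓ 0) (≤-reflexive (≡-sym Fj₀)))
        (F-mono (s≤s⁻¹ (≤-trans (toℕ<n j₀) (≮⇒≥ 1+i≮m))))
      next-left : toℕ (φ (next i)) < ℓ
      next-left rewrite toℕ-φ (next i) | next-wrap i 1+i≮m =
        ≤-trans (s≤s (≤-trans (F-mono {0} {toℕ i₀} z≤n) (≤-reflexive Fi₀))) ℓ≥1
      opp : opposite (φ i) (φ (next i)) ≡ true
      opp rewrite <ᵇ-false i-right | <ᵇ-true next-left = refl

    forward : ∀ i j → toℕ i ≤ toℕ j → φ i ≡ φ j → ForwardArc (λ k → φ k ≡ φ i) i j
    forward i j i≤j φi≡φj = t , toℕ-injective (trans (iter-next t i (subst (_< m) (≡-sym i+t) (toℕ<n j))) i+t) , within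
      where
      t = toℕ j ∸ toℕ i
      i+t : toℕ i + t ≡ toℕ j
      i+t = m+[n∸m]≡n i≤j
      within : ∀ s → s ≤ t → φ (iter s next i) ≡ φ i
      within s s≤t = φ-≡ (trans (cong F s-eq) (≤-antisym
          (≤-trans (F-mono i+s≤j) (≤-reflexive (trans (≡-sym (toℕ-φ j)) (cong toℕ (≡-sym φi≡φj)))))
          (≤-trans (≤-reflexive (toℕ-φ i)) (F-mono (m≤m+n (toℕ i) s)))))
        where
        i+s≤j : toℕ i + s ≤ toℕ j
        i+s≤j = ≤-trans (+-monoʳ-≤ (toℕ i) s≤t) (≤-reflexive i+t)
        s-eq = iter-next s i (≤-<-trans i+s≤j (toℕ<n j))

    φ-arcs : ∀ i j → φ i ≡ φ j →
      ForwardArc (λ k → φ k ≡ φ i) i j ⊎ ForwardArc (λ k → φ k ≡ φ i) j i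
    φ-arcs i j eq with ≤-total (toℕ i) (toℕ j)
    ... | inj₁ i≤j = inj₁ (forward i j i≤j eq)
    ... | inj₂ j≤i with forward j i j≤i (≡-sym eq)
    ...   | t , arrive , within = inj₂ (t , arrive , λ s s≤t → trans (within s s≤t) (≡-sym eq))

    Realised : Fin (ℓ + ℓ) → Fin (ℓ + ℓ) → Set
    Realised x y = ∃ λ i → ∃ λ j → φ i ≡ x × φ j ≡ y × S i j ≡ true

    realised-sym : ∀ {x y} → Realised x y → Realised y x
    realised-sym (i , j , φi , φj , Sij) = j , i , φj , φi , trans (S-sym j i) Sij

    realised-opposite : ∀ x y → toℕ x < ℓ → ℓ ≤ toℕ y → Realised x y
    realised-opposite x y x<ℓ ℓ≤y
      with chord x<ℓ (+-cancelˡ-< ℓ _ _ (subst (_< ℓ + ℓ) (≡-sym (m+[n∸m]≡n ℓ≤y)) (toℕ<n y)))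
    ... | i , j , Fi , Fj , ij = i , j , φi , φj , S-opposite i j ij opp
      where
      φi = φ-≡ {i} Fi
      φj = φ-≡ {j} (trans Fj (m+[n∸m]≡n ℓ≤y))
      opp : opposite (φ i) (φ j) ≡ true
      opp rewrite φi | φj | <ᵇ-true x<ℓ | <ᵇ-false ℓ≤y = refl

    realised-suc : ∀ x y → suc (toℕ x) ≡ toℕ y → Realised x y
    realised-suc x y eq with F-crossing (subst (_< ℓ + ℓ) (≡-sym eq) (toℕ<n y))
    ... | i , Fi , Fnext = i , next i , φ-≡ Fi , φ-≡ (trans Fnext eq) , S-next i

    realised : ∀ x y → K′ ℓ x y ≡ true → Realised x y
    realised x y edge with K′⁻ x y edge
    ... | inj₂ (inj₁ xy) = realised-suc x y xy
    ... | inj₂ (inj₂ yx) = realised-sym (realised-suc y x yx)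
    ... | inj₁ opp with opposite⁻ x y opp
    ...   | inj₁ (x<ℓ , ℓ≤y) = realised-opposite x y x<ℓ ℓ≤y
    ...   | inj₂ (ℓ≤x , y<ℓ) = realised-sym (realised-opposite y x y<ℓ ℓ≤x)

    realised⁻ : ∀ x y → x ≢ y → Realised x y → K′ ℓ x y ≡ true
    realised⁻ _ _ x≢y (i , j , refl , refl , Sij) with S⁻ i j Sij
    ... | inj₁ opp         = K′-opposite (φ i) (φ j) opp
    ... | inj₂ (inj₁ refl) = K′-next i x≢y
    ... | inj₂ (inj₂ refl) = trans (K′-sym (φ i) (φ j)) (K′-next j (x≢y ∘ ≡-sym))

    model : CyclicMinorModel (K′ ℓ) G
    model = record
      { m = m ; m≥3 = m≥3 ; c = c ; c-inj = c-inj
      ; S = S ; S-sym = S-sym ; S⊆G = S⊆G ; ham = S-next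
      ; φ = φ
      ; φ-surj = λ x → let i , Fi = F-surj (toℕ<n x) in i , λ { refl → φ-≡ Fi }
      ; φ-arcs = φ-arcs
      ; φ-edges = λ x y x≢y → realised x y , realised⁻ x y x≢y }

-- From a dense cycle to a labelled cycle

module _ {X : Set} where

  nth : List X → ℕ → Maybe X
  nth []       _       = nothing
  nth (x ∷ xs) zero    = just x
  nth (x ∷ xs) (suc i) = nth xs i

  ∑-nth : ∀ (h : X → ℕ) xs → ∑ (length xs) (λ i → maybe h 0 (nth xs i)) ≡ sum (map h xs)
  ∑-nth h []       = refl
  ∑-nth h (x ∷ xs) = trans (∑-++ 1 (length xs) _) (cong (h x +_) (∑-nth h xs))

  -- Within the list, r counts the selected elements before a position. Composing with r extends a
  -- monotone labelling of the selected elements to all positions of the cycle.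
  filter-rank : ∀ {Q : X → Set} (Q? : Decidable Q) xs →
    ∃ λ r → Mono r × (∀ {a x} → nth (filter Q? xs) a ≡ just x → ∃ λ i → lookup xs i ≡ x × r (toℕ i) ≡ a)
  filter-rank Q? [] = (λ p → p) , (λ p≤q → p≤q) , λ ()
  filter-rank {Q} Q? (x ∷ xs) with Q? x | filter-rank Q? xs
  ... | yes _ | r , r-mono , select = r′ , r′-mono , select′
    where
    r′ : ℕ → ℕ
    r′ zero    = zero
    r′ (suc p) = suc (r p)
    r′-mono : Mono r′
    r′-mono z≤n       = z≤n
    r′-mono (s≤s p≤q) = s≤s (r-mono p≤q)
    select′ : ∀ {a y} → nth (x ∷ filter Q? xs) a ≡ just y → ∃ λ i → lookup (x ∷ xs) i ≡ y × r′ (toℕ i) ≡ a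
    select′ {zero}  refl = Fin.zero , refl , refl
    select′ {suc a} eq with select eq
    ... | i , xi , ri = Fin.suc i , xi , cong suc ri
  ... | no _ | r , r-mono , select = r′ , r′-mono , select′
    where
    r′ : ℕ → ℕ
    r′ zero    = zero
    r′ (suc p) = r p
    r′-mono : Mono r′
    r′-mono z≤n       = z≤n
    r′-mono (s≤s p≤q) = r-mono p≤q
    select′ : ∀ {a y} → nth (filter Q? xs) a ≡ just y → ∃ λ i → lookup (x ∷ xs) i ≡ y × r′ (toℕ i) ≡ a
    select′ eq with select eq
    ... | i , xi , ri = Fin.suc i , xi , ri

  lookup-injective : ∀ {xs : List X} → Unique xs → ∀ {i j} → lookup xs i ≡ lookup xs j → i ≡ j
  lookup-injective (x≢ ∷ u) {Fin.zero}  {Fin.zero}  eq = refl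
  lookup-injective (x≢ ∷ u) {Fin.zero}  {Fin.suc j} eq = ⊥-elim (All.lookup x≢ (∈-lookup j) eq)
  lookup-injective (x≢ ∷ u) {Fin.suc i} {Fin.zero}  eq = ⊥-elim (All.lookup x≢ (∈-lookup i) (≡-sym eq))
  lookup-injective (x≢ ∷ u) {Fin.suc i} {Fin.suc j} eq = cong Fin.suc (lookup-injective u eq)

  lookup-consecutive : ∀ (xs : List X) i j → toℕ j ≡ suc (toℕ i) → Consecutive (lookup xs i) (lookup xs j) xs
  lookup-consecutive (x ∷ y ∷ xs) Fin.zero    (Fin.suc Fin.zero) eq = here
  lookup-consecutive (x ∷ xs)     (Fin.suc i) (Fin.suc j)        eq =
    there (lookup-consecutive xs i j (suc-injective eq))

  lookup-last : ∀ (xs : List X) v i → suc (toℕ i) ≡ length (xs ++ [ v ]) → lookup (xs ++ [ v ]) i ≡ v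
  lookup-last []           v Fin.zero    eq = refl
  lookup-last (x ∷ xs)     v (Fin.suc i) eq = lookup-last xs v i (suc-injective eq)
  lookup-last (x ∷ y ∷ xs) v Fin.zero    ()

  sum-≥ : ∀ {h : X → ℕ} {k} xs → (∀ {x} → x ∈ xs → k ≤ h x) → length xs * k ≤ sum (map h xs)
  sum-≥ []       k≤h = z≤n
  sum-≥ (x ∷ xs) k≤h = +-mono-≤ (k≤h (here refl)) (sum-≥ xs (k≤h ∘ there))

  sum-ind≤length : ∀ (h : X → Bool) xs → sum (map (ind ∘ h) xs) ≤ length xs
  sum-ind≤length h []       = z≤n
  sum-ind≤length h (x ∷ xs) = +-mono-≤ (ind≤1 (h x)) (sum-ind≤length h xs)

  nonempty⇒∃∈ : ∀ {xs : List X} → 1 ≤ length xs → ∃ λ x → x ∈ xs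
  nonempty⇒∃∈ {x ∷ xs} _ = x , here refl

lookup-first : ∀ {X : Set} {x : X} {xs} (i : Fin (length (x ∷ xs))) → toℕ i ≡ 0 → lookup (x ∷ xs) i ≡ x
lookup-first Fin.zero _ = refl

module _ (ℓ : ℕ) (ℓ≥1 : 1 ≤ ℓ) where

  -- Labels below ℓ are read off f, the others off g (clipped to [ℓ, 2ℓ)).
  join : (f g : ℕ → ℕ) → ℕ → ℕ
  join f g p with f p <? ℓ
  ... | yes _ = f p
  ... | no _  = ℓ ⊔ (g p ⊓ pred (ℓ + ℓ))

  join-low : ∀ f g p → f p < ℓ → join f g p ≡ f p
  join-low f g p fp<ℓ with f p <? ℓ
  ... | yes _    = refl
  ... | no fp≮ℓ  = ⊥-elim (fp≮ℓ fp<ℓ)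

  2ℓ≥1 : 1 ≤ ℓ + ℓ
  2ℓ≥1 = ≤-trans ℓ≥1 (m≤m+n ℓ ℓ)

  pred[2ℓ]<2ℓ : pred (ℓ + ℓ) < ℓ + ℓ
  pred[2ℓ]<2ℓ = ≤-reflexive (suc-pred (ℓ + ℓ) ⦃ >-nonZero 2ℓ≥1 ⦄)

  join-high : ∀ f g p {b} → ℓ ≤ f p → b < ℓ → g p ≡ ℓ + b → join f g p ≡ ℓ + b
  join-high f g p {b} ℓ≤fp b<ℓ gp with f p <? ℓ
  ... | yes fp<ℓ = ⊥-elim (<⇒≱ fp<ℓ ℓ≤fp)
  ... | no _ rewrite gp = trans
    (cong (ℓ ⊔_) (m≤n⇒m⊓n≡m (s≤s⁻¹ (≤-trans (+-monoʳ-< ℓ b<ℓ) (≤-reflexive (≡-sym (suc-pred (ℓ + ℓ) ⦃ >-nonZero 2ℓ≥1 ⦄)))))))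
    (m≤n⇒m⊔n≡n (m≤m+n ℓ b))

  join-mono : ∀ {f g} → Mono f → Mono g → Mono (join f g)
  join-mono {f} {g} f-mono g-mono {p} {q} p≤q with f p <? ℓ | f q <? ℓ
  ... | yes _    | yes _    = f-mono p≤q
  ... | yes fp<ℓ | no _     = ≤-trans (<⇒≤ fp<ℓ) (m≤m⊔n ℓ _)
  ... | no fp≮ℓ  | yes fq<ℓ = ⊥-elim (fp≮ℓ (≤-<-trans (f-mono p≤q) fq<ℓ))
  ... | no _     | no _     = ⊔-monoʳ-≤ ℓ (⊓-monoˡ-≤ (pred (ℓ + ℓ)) (g-mono p≤q))

  join<2ℓ : ∀ f g p → join f g p < ℓ + ℓ
  join<2ℓ f g p with f p <? ℓ
  ... | yes fp<ℓ = <-≤-trans fp<ℓ (m≤m+n ℓ ℓ)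
  ... | no _     = ⊔-pres-<m (m<m+n ℓ ℓ≥1) (≤-<-trans (m⊓n≤n (g p) (pred (ℓ + ℓ))) pred[2ℓ]<2ℓ)

  module _ {n : ℕ} (G : Graph n) where

    open Posa G

    Chords : List V → (f g : ℕ → ℕ) → Set
    Chords C f g = ∀ {a b} → a < ℓ + ℓ → b < ℓ + ℓ →
      ∃₂ λ i j → f (toℕ i) ≡ a × g (toℕ j) ≡ b × lookup C i ~ lookup C j

    Labelling : List V → Set
    Labelling C = ∃ λ F → Mono F × (∀ p → F p < ℓ + ℓ) ×
      (∀ {a b} → a < ℓ → b < ℓ → ∃₂ λ i j → F (toℕ i) ≡ a × F (toℕ j) ≡ ℓ + b × lookup C i ~ lookup C j)

    -- By `ordered`, a position with column label at least ℓ is not claimed by a row label below ℓ,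
    -- so `join` reads g there. One of the two orders of f and g always qualifies: a position with f
    -- < ℓ ≤ g forces g ≥ ℓ wherever f ≥ ℓ.
    join-labelling : ∀ C {f g} → Mono f → Mono g → Chords C f g →
      (∀ (j : Fin (length C)) → ℓ ≤ g (toℕ j) → ℓ ≤ f (toℕ j)) → Labelling C
    join-labelling C {f} {g} f-mono g-mono chords ordered =
      join f g , join-mono f-mono g-mono , join<2ℓ f g , λ a<ℓ b<ℓ →
        let i , j , fi , gj , i~j = chords (<-≤-trans a<ℓ (m≤m+n ℓ ℓ)) (+-monoʳ-< ℓ b<ℓ)
        in i , j ,
           trans (join-low f g (toℕ i) (subst (_< ℓ) (≡-sym fi) a<ℓ)) fi ,
           join-high f g (toℕ j) (ordered j (subst (ℓ ≤_) (≡-sym gj) (m≤m+n ℓ _))) b<ℓ gj ,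
           i~j

    -- Either the first ℓ row intervals precede the last ℓ column intervals, or the first ℓ
    -- column intervals precede the last ℓ row intervals.
    labelling : ∀ C {f g} → Mono f → Mono g → Chords C f g → Labelling C
    labelling C {f} {g} f-mono g-mono chords
      with Fin.any? {n = length C} (λ j → (ℓ ≤? g (toℕ j)) ×-dec (f (toℕ j) <? ℓ))
    ... | no none = join-labelling C f-mono g-mono chords λ j ℓ≤gj →
      ≮⇒≥ λ fj<ℓ → none (j , ℓ≤gj , fj<ℓ)
    ... | yes (j₀ , ℓ≤gj₀ , fj₀<ℓ) = join-labelling C g-mono f-mono
      (λ a<2ℓ b<2ℓ → let i , j , fi , gj , i~j = chords b<2ℓ a<2ℓ in j , i , gj , fi , ~-sym i~j)
      λ j ℓ≤fj → ≤-trans ℓ≤gj₀ (g-mono (≰⇒≥ λ j≤j₀ → <⇒≱ (≤-<-trans (f-mono j≤j₀) fj₀<ℓ) ℓ≤fj))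

    labelling⇒model : ∀ {C} → 3 ≤ length C → Unique C →
      (∀ i → lookup C i ~ lookup C (next i)) → Labelling C → IsCyclicMinor (K′ ℓ) G
    labelling⇒model {C} C≥3 unique cyclic (F , F-mono , F<2ℓ , chord) =
      Contraction.model ℓ G C≥3 (lookup C) (lookup-injective unique) cyclic ℓ≥1 F F-mono F<2ℓ chord

    edge : Maybe V → Maybe V → Bool
    edge (just u) (just v) = adj G u v
    edge _        _        = false

    -- Indices beyond the end of D give zeros. As the entries hit by a grid are not confined to a
    -- finite range, this padding is what makes each of them an edge between vertices of D.
    matrix : List V → Matrix
    matrix D a b = edge (nth D a) (nth D b)

    edge⁻ : ∀ x y → edge x y ≡ true → ∃₂ λ u v → x ≡ just u × y ≡ just v × u ~ v
    edge⁻ (just u) (just v) u~v = u , v , refl , refl , u~v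

    grid⇒labelling : ∀ {Q : V → Set} (Q? : Decidable Q) C → Grid (ℓ + ℓ) (matrix (filter Q? C)) → Labelling C
    grid⇒labelling Q? C grid with filter-rank Q? C
    ... | r , r-mono , select = labelling C (f-mono ∘ r-mono) (g-mono ∘ r-mono) chords
      where
      open Grid grid
      chords : Chords C (f ∘ r) (g ∘ r)
      chords a<2ℓ b<2ℓ with hit a<2ℓ b<2ℓ
      ... | a , b , fa , gb , one with edge⁻ _ _ one
      ...   | u , v , ua , vb , u~v with select ua | select vb
      ...     | i , refl , ri | j , refl , rj = i , j , trans (cong f ri) fa , trans (cong g rj) gb , u~v

    degreeIn : List V → V → ℕ
    degreeIn D u = sum (map (ind ∘ adj G u) D)

    ones-matrix : ∀ D → ones (length D) (matrix D) ≡ sum (map (degreeIn D) D)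
    ones-matrix D = trans (∑-cong (length D) λ a _ → row (nth D a)) (∑-nth (degreeIn D) D)
      where
      cell : ∀ u y → ind (edge (just u) y) ≡ maybe (ind ∘ adj G u) 0 y
      cell u (just v) = refl
      cell u nothing  = refl
      row : ∀ x → # (length D) (λ b → edge x (nth D b)) ≡ maybe (degreeIn D) 0 x
      row (just u) = trans (∑-cong (length D) λ b _ → cell u (nth D b)) (∑-nth (ind ∘ adj G u) D)
      row nothing  = trans (∑-const (length D) 0) (*-zeroʳ (length D))

    degree≤degreeIn : ∀ {u D} → (∀ {w} → u ~ w → w ∈ D) → degree G u ≤ degreeIn D u
    degree≤degreeIn {u} {D} N⊆D = sum-⊆ (ind ∘ adj G u) (allFin⁺ n) λ {w} _ → cover w
      where
      cover : ∀ w → ind (adj G u w) ≡ 0 ⊎ w ∈ D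
      cover w with adj G u w in eq
      ... | true  = inj₂ (N⊆D eq)
      ... | false = inj₁ refl

    degree>0⇒neighbour : ∀ u → 1 ≤ degree G u → ∃ λ w → u ~ w
    degree>0⇒neighbour u 1≤deg with Fin.any? (u ~?_)
    ... | yes nbr = nbr
    ... | no none = ⊥-elim (<⇒≱ 1≤deg (degree≤degreeIn {D = []} λ u~w → ⊥-elim (none (_ , u~w))))

    module _ {d : ℕ} (forces-grid : ForcesGrid (ℓ + ℓ) d)
             (min-degree : ∀ v → 3 + d * 3 ≤ degree G v) (dense : DenseCycle) where

      open DenseCycle dense
      open IsPath isPath

      private
        k = 3 + d * 3

      D : List V
      D = filter (_∈? U) cycle

      R⊆D : ∀ {u} → u ∈ R → u ∈ D
      R⊆D u∈R = ∈-filter⁺ (_∈? U) (R⊆cycle u∈R) (R⊆U u∈R)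

      k≤degreeIn : ∀ {u} → u ∈ R → k ≤ degreeIn D u
      k≤degreeIn {u} u∈R = ≤-trans (min-degree u)
        (degree≤degreeIn λ u~w → ∈-filter⁺ (_∈? U) (N⊆cycle u∈R u~w) (N⊆U u∈R u~w))

      -- Only the rows of R are counted; each has at least k ones, because D contains all neighbours
      -- of R. The bound on |D| uses that D has no repetitions, whereas `U` may have some.
      D-dense : d * length D < ones (length D) (matrix D)
      D-dense = begin-strict
        d * length D
          ≤⟨ *-monoʳ-≤ d (length-⊆ (filter⁺ (_∈? U) unique) λ x∈D → proj₂ (∈-filter⁻ (_∈? U) x∈D)) ⟩
        d * length U
          ≤⟨ *-monoʳ-≤ d |U|≤3|R| ⟩
        d * (3 * length R)
          ≡⟨ solve 2 (λ d r → d :* (con 3 :* r) := r :* (d :* con 3)) refl d (length R) ⟩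
        length R * (d * 3)
          <⟨ *-monoʳ-< (length R) ⦃ >-nonZero R-nonempty ⦄ (s≤s (m≤n+m _ 2)) ⟩
        length R * k
          ≤⟨ sum-≥ R k≤degreeIn ⟩
        sum (map (degreeIn D) R)
          ≤⟨ sum-⊆ (degreeIn D) R-unique (inj₂ ∘ R⊆D) ⟩
        sum (map (degreeIn D) D)
          ≡⟨ ones-matrix D ⟨
        ones (length D) (matrix D) ∎
        where
        open ≤-Reasoning
        open +-*-Solver

      cycle-labelling : Labelling cycle
      cycle-labelling = grid⇒labelling (_∈? U) cycle (forces-grid (matrix D) (length D)
        (≤-trans R-nonempty (length-⊆ R-unique R⊆D)) D-dense)

      cycle≥3 : 3 ≤ length cycle
      cycle≥3 with nonempty⇒∃∈ R-nonempty
      ... | u , u∈R = ≤-trans (m≤m+n 3 _) (≤-trans (min-degree u)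
        (≤-trans (degree≤degreeIn (N⊆cycle u∈R)) (sum-ind≤length (adj G u) cycle)))

      cycle-cyclic : ∀ i → lookup cycle i ~ lookup cycle (next i)
      cycle-cyclic i = by-position (suc (toℕ i) <? length cycle)
        where
        by-position : Dec (suc (toℕ i) < length cycle) → lookup cycle i ~ lookup cycle (next i)
        by-position (yes 1+i<m) = linked (lookup-consecutive cycle i (next i) (next-toℕ i 1+i<m))
        by-position (no 1+i≮m)  = subst₂ _~_
          (≡-sym (lookup-last (first ∷ middle) last i (≤-antisym (toℕ<n i) (≮⇒≥ 1+i≮m))))
          (≡-sym (lookup-first {xs = middle ++ [ last ]} (next i) (next-wrap i 1+i≮m)))
          closing

      denseCycle⇒model : IsCyclicMinor (K′ ℓ) G
      denseCycle⇒model = labelling⇒model cycle≥3 unique cycle-cyclic cycle-labelling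

theorem3 : (ℓ : ℕ) → 1 ≤ ℓ →
    ∃ λ k → ∀ (n : ℕ) (G : Graph n) → 0 < n →
    (∀ v → k ≤ degree G v) → IsCyclicMinor (K′ ℓ) G
theorem3 ℓ ℓ≥1 = 3 + d * 3 , λ n G 0<n min-degree →
  denseCycle⇒model ℓ ℓ≥1 G {d} dense⇒grid min-degree
    (Posa.denseCycle G (fromℕ< 0<n) λ u →
      degree>0⇒neighbour ℓ ℓ≥1 G u (≤-trans (s≤s z≤n) (min-degree u)))
  where
  open MarcusTardos (ℓ + ℓ) (2ℓ≥1 ℓ ℓ≥1)
  d = density * s
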